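{- Let $\mathcal{O}$ be a Dedekind domain and let $\mathcal{L}\supseteq \mathcal{K}$ be fixed nonzero ideals of $\mathcal{O}$, with $\mathcal{I}$ the ideal given by the factorization $\mathcal{K}=\mathcal{L}\mathcal{I}$. Then there is a bijection between the set of co-torsion submodules (of rank two) $M\subseteq\mathcal{O}^2$ having invariant factor ideals $\mathcal{L}\supseteq \mathcal{K}$ and the projective space $\mathbb{PF}^1_{\mathcal{I}}$.
   Context: An $\mathcal{O}$-submodule $M\subseteq \mathcal{O}^2$ is co-torsion if $\mathcal{O}^2/M$ is a torsion $\mathcal{O}$-module; such a module automatically has rank two (a maximal $\mathcal{O}$-linearly independent subset has two elements). Invariant factor ideals: for a co-torsion $M\subseteq\mathcal{O}^2$ there are finitely many distinct maximal ideals $\mathcal{M}_1,\dots,\mathcal{M}_r$ of $\mathcal{O}$ and integers $0\le l_i\le k_i\ne 0$ with $\mathcal{O}^2/M\cong\bigoplus_{i=1}^r\big(\mathcal{O}/\mathcal{M}_i^{l_i}\oplus\mathcal{O}/\mathcal{M}_i^{k_i}\big)$ ($r=0$ if $M=\mathcal{O}^2$). The invariant factor ideals of $M$ are $\mathcal{L}=\prod_{i}\mathcal{M}_i^{l_i}\supseteq\mathcal{K}=\prod_{i}\mathcal{M}_i^{k_i}$, so $\mathcal{O}^2/M\cong\mathcal{O}/\mathcal{L}\oplus\mathcal{O}/\mathcal{K}$ (both are $\mathcal{O}$ if $M=\mathcal{O}^2$). Projective space: let $(\mathcal{O}^2)^{*}=\{(a,b)\in \mathcal{O}^2\mid \langle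 a\rangle +\langle b\rangle = \mathcal{O}\}$. For an ideal $\mathcal{I}\subseteq\mathcal{O}$, define the equivalence relation on $(\mathcal{O}^2)^*$ by $(a,b)\sim (c,d)$ iff $ad-bc\in \mathcal{I}$. Then $\mathbb{PF}^1_{\mathcal{I}}=(\mathcal{O}^2)^{*}/\sim$. -}

module Defs where

open import Algebra.Bundles using (CommutativeMonoid; CommutativeRing; Monoid; Semiring)
open import Algebra.Module.Bundles using (LeftModule)
open import Algebra.Module.Morphism.Structures using (IsLeftModuleIsomorphism)
import Algebra.Module.Construct.DirectProduct as DirectProduct
import Algebra.Module.Construct.TensorUnit as TensorUnit
import Algebra.Module.Construct.Zero as Zero
import Algebra.Definitions.RawMonoid as RawMonoidDefs
import Algebra.Definitions.RawSemiring as RawSemiringDefs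
import Algebra.Module.Properties.LeftModule as LeftModuleProperties
import Algebra.Properties.AbelianGroup as AbelianGroupProperties
import Algebra.Properties.CommutativeSemigroup as CommutativeSemigroupProperties
import Algebra.Properties.Ring as RingProperties
import Algebra.Solver.Ring.NaturalCoefficients.Default as SemiringSolver
open import Data.Fin.Base using (Fin; toℕ)
open import Data.Nat.Base as ℕ using (ℕ; zero; suc; _∸_)
open import Data.Product.Base using (Σ; Σ-syntax; ∃; ∃-syntax; _×_; _,_; proj₁; proj₂)
open import Data.Sum.Base using (_⊎_)
import Data.Unit.Polymorphic.Base as Unit
open import Data.Vec.Functional as Vector using (Vector)
open import Level using (Level; _⊔_) renaming (suc to lsuc)
open import Relation.Binary.Bundles using (Setoid)
open import Relation.Binary.PropositionalEquality.Core using (_≢_)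
import Relation.Binary.Reasoning.Setoid as SetoidReasoning
open import Relation.Nullary.Negation.Core using (¬_)
open import Relation.Unary using (Pred; _∈_; _⊆_; _≐_)
open import Relation.Unary.Properties using (≐-refl; ≐-sym; ≐-trans)

private
  module DeterminantIdentities {c ℓ : Level} (O : CommutativeRing c ℓ) where

    open CommutativeRing O
    open SemiringSolver commutativeSemiring using (solve; _:+_; _:*_; _:=_; con)
    open RingProperties ring using (-1*x≈-x)
    open AbelianGroupProperties +-abelianGroup using (⁻¹-anti-homo‿-)

    swap : ∀ a b a′ b′ → (- 1#) * (a * b′ - b * a′) ≈ a′ * b - b′ * a
    swap a b a′ b′ = trans (-1*x≈-x (a * b′ - b * a′))
      (trans (⁻¹-anti-homo‿- (a * b′) (b * a′))
        (+-cong (*-comm b a′) (-‿cong (*-comm a b′))))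

    -- The solver has no negation, so the sign is carried by a variable ε that
    -- is later set to - 1#.
    signed : ∀ ε s t a b a′ b′ a″ b″ →
      s * (a * (a′ * b″ + ε * (b′ * a″)) + a″ * (a * b′ + ε * (b * a′))) +
      t * (b″ * (a * b′ + ε * (b * a′)) + b * (a′ * b″ + ε * (b′ * a″)))
      ≈ (s * a′ + t * b′) * (a * b″ + ε * (b * a″)) +
        (1# + ε) * (s * a * b′ * a″ + t * b * a′ * b″)
    signed = solve 9 (λ ε s t a b a′ b′ a″ b″ →
      s :* (a :* (a′ :* b″ :+ ε :* (b′ :* a″)) :+ a″ :* (a :* b′ :+ ε :* (b :* a′))) :+
      t :* (b″ :* (a :* b′ :+ ε :* (b :* a′)) :+ b :* (a′ :* b″ :+ ε :* (b′ :* a″)))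
      := (s :* a′ :+ t :* b′) :* (a :* b″ :+ ε :* (b :* a″)) :+
         (con 1 :+ ε) :* (s :* a :* b′ :* a″ :+ t :* b :* a′ :* b″)) refl

    combine : ∀ s t a b a′ b′ a″ b″ →
      s * (a * (a′ * b″ - b′ * a″) + a″ * (a * b′ - b * a′)) +
      t * (b″ * (a * b′ - b * a′) + b * (a′ * b″ - b′ * a″))
      ≈ (s * a′ + t * b′) * (a * b″ - b * a″)
    combine s t a b a′ b′ a″ b″ = begin
      s * (a * (a′ * b″ - b′ * a″) + a″ * (a * b′ - b * a′)) +
      t * (b″ * (a * b′ - b * a′) + b * (a′ * b″ - b′ * a″))
        ≈⟨ +-cong
             (*-congˡ (+-cong (*-congˡ (sign (b′ * a″))) (*-congˡ (sign (b * a′)))))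
             (*-congˡ (+-cong (*-congˡ (sign (b * a′))) (*-congˡ (sign (b′ * a″))))) ⟩
      s * (a * (a′ * b″ + (- 1#) * (b′ * a″)) + a″ * (a * b′ + (- 1#) * (b * a′))) +
      t * (b″ * (a * b′ + (- 1#) * (b * a′)) + b * (a′ * b″ + (- 1#) * (b′ * a″)))
        ≈⟨ signed (- 1#) s t a b a′ b′ a″ b″ ⟩
      (s * a′ + t * b′) * (a * b″ + (- 1#) * (b * a″)) +
      (1# - 1#) * (s * a * b′ * a″ + t * b * a′ * b″)
        ≈⟨ +-congˡ (trans (*-congʳ (-‿inverseʳ 1#)) (zeroˡ _)) ⟩
      (s * a′ + t * b′) * (a * b″ + (- 1#) * (b * a″)) + 0#
        ≈⟨ +-identityʳ _ ⟩
      (s * a′ + t * b′) * (a * b″ + (- 1#) * (b * a″))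
        ≈⟨ *-congˡ (sign (b * a″)) ⟨
      (s * a′ + t * b′) * (a * b″ - b * a″) ∎
      where
      open SetoidReasoning setoid

      sign : ∀ {x} y → x - y ≈ x + (- 1#) * y
      sign y = +-congˡ (sym (-1*x≈-x y))

-- As O is commutative, O-modules are represented by left O-modules.
module OverRing {c ℓ : Level} (O : CommutativeRing c ℓ) where

  open CommutativeRing O hiding (zero)
  open RawSemiringDefs (Semiring.rawSemiring semiring) using (_^_; _∣_; sum)

  private
    variable
      m ℓm m′ ℓm′ p : Level

  infix 4 _≅_

  _≅_ : LeftModule ring m ℓm → LeftModule ring m′ ℓm′ →
        Set (c ⊔ m ⊔ m′ ⊔ ℓm ⊔ ℓm′)
  M ≅ N = ∃ (IsLeftModuleIsomorphism (LeftModule.rawLeftModule M)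
                                     (LeftModule.rawLeftModule N))

  record Submodule (M : LeftModule ring m ℓm) (p : Level) :
                   Set (c ⊔ m ⊔ ℓm ⊔ lsuc p) where
    open LeftModule M
    field
      Mem    : Pred Carrierᴹ p
      resp   : ∀ {x y} → x ≈ᴹ y → x ∈ Mem → y ∈ Mem
      0-mem  : 0ᴹ ∈ Mem
      +-mem  : ∀ {x y} → x ∈ Mem → y ∈ Mem → (x +ᴹ y) ∈ Mem
      *-mem  : ∀ r {x} → x ∈ Mem → (r *ₗ x) ∈ Mem

  open Submodule public using (Mem)

  infix 4 _≈ˢ_ _⊆ˢ_

  _≈ˢ_ : {M : LeftModule ring m ℓm} → Submodule M p → Submodule M p → Set (m ⊔ p)
  N ≈ˢ N′ = Mem N ≐ Mem N′

  _⊆ˢ_ : {M : LeftModule ring m ℓm} → Submodule M p → Submodule M p → Set (m ⊔ p)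
  N ⊆ˢ N′ = Mem N ⊆ Mem N′

  -- Quotients are setoid quotients: the carrier of M / N is that of M, and
  -- x , y are identified when x - y ∈ N.
  infixl 7 _/_

  _/_ : (M : LeftModule ring m ℓm) → Submodule M p → LeftModule ring m p
  _/_ M N = record
    { Carrierᴹ = Carrierᴹ
    ; _≈ᴹ_ = λ x y → (x +ᴹ -ᴹ y) ∈ Mem N
    ; _+ᴹ_ = _+ᴹ_
    ; _*ₗ_ = _*ₗ_
    ; 0ᴹ = 0ᴹ
    ; -ᴹ_ = -ᴹ_
    ; isLeftModule = record
      { isLeftSemimodule = record
        { +ᴹ-isCommutativeMonoid = record
          { isMonoid = record
            { isSemigroup = record
              { isMagma = record
                { isEquivalence = record
                  { refl = lift ≈ᴹ-refl
                  ; sym = λ {x} {y} → symm x y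
                  ; trans = λ {x} {y} {z} → tran x y z }
                ; ∙-cong = λ {x} {y} {u} {v} → cong+ x y u v }
              ; assoc = λ x y z → lift (+ᴹ-assoc x y z) }
            ; identity = (λ x → lift (+ᴹ-identityˡ x)) , (λ x → lift (+ᴹ-identityʳ x)) }
          ; comm = λ x y → lift (+ᴹ-comm x y) }
        ; isPreleftSemimodule = record
          { *ₗ-cong = λ {r} {s} {x} {y} → cong* r s x y
          ; *ₗ-zeroˡ = λ x → lift (*ₗ-zeroˡ x)
          ; *ₗ-distribʳ = λ x r s → lift (*ₗ-distribʳ x r s)
          ; *ₗ-identityˡ = λ x → lift (*ₗ-identityˡ x)
          ; *ₗ-assoc = λ r s x → lift (*ₗ-assoc r s x)
          ; *ₗ-zeroʳ = λ r → lift (*ₗ-zeroʳ r)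
          ; *ₗ-distribˡ = λ r x y → lift (*ₗ-distribˡ r x y) } }
      ; -ᴹ‿cong = λ {x} {y} → cong- x y
      ; -ᴹ‿inverse = (λ x → lift (-ᴹ‿inverseˡ x)) , (λ x → lift (-ᴹ‿inverseʳ x)) } }
    where
    open LeftModule M
    open LeftModuleProperties M using (-ᴹ-involutive; inverseʳ-uniqueᴹ)
    open CommutativeSemigroupProperties
      (CommutativeMonoid.commutativeSemigroup +ᴹ-commutativeMonoid)
      using (interchange)
    open Submodule N
    open SetoidReasoning ≈ᴹ-setoid

    lift : ∀ {x y} → x ≈ᴹ y → (x +ᴹ -ᴹ y) ∈ Mem N
    lift {x} {y} x≈y =
      resp (≈ᴹ-sym (≈ᴹ-trans (+ᴹ-congʳ x≈y) (-ᴹ‿inverseʳ y))) 0-mem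

    -1* : ∀ x → (- 1#) *ₗ x ≈ᴹ -ᴹ x
    -1* x = inverseʳ-uniqueᴹ x ((- 1#) *ₗ x) (begin
      x +ᴹ (- 1#) *ₗ x          ≈⟨ +ᴹ-congʳ (*ₗ-identityˡ x) ⟨
      1# *ₗ x +ᴹ (- 1#) *ₗ x    ≈⟨ *ₗ-distribʳ x 1# (- 1#) ⟨
      (1# + - 1#) *ₗ x          ≈⟨ *ₗ-congʳ (-‿inverseʳ 1#) ⟩
      0# *ₗ x                   ≈⟨ *ₗ-zeroˡ x ⟩
      0ᴹ ∎)

    neg-mem : ∀ {x} → x ∈ Mem N → (-ᴹ x) ∈ Mem N
    neg-mem {x} x∈ = resp (-1* x) (*-mem (- 1#) x∈)

    neg-+ : ∀ x y → -ᴹ (x +ᴹ y) ≈ᴹ -ᴹ x +ᴹ -ᴹ y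
    neg-+ x y = ≈ᴹ-sym (inverseʳ-uniqueᴹ (x +ᴹ y) (-ᴹ x +ᴹ -ᴹ y) (begin
      (x +ᴹ y) +ᴹ (-ᴹ x +ᴹ -ᴹ y)    ≈⟨ interchange x y (-ᴹ x) (-ᴹ y) ⟩
      (x +ᴹ -ᴹ x) +ᴹ (y +ᴹ -ᴹ y)    ≈⟨ +ᴹ-cong (-ᴹ‿inverseʳ x) (-ᴹ‿inverseʳ y) ⟩
      0ᴹ +ᴹ 0ᴹ                      ≈⟨ +ᴹ-identityˡ 0ᴹ ⟩
      0ᴹ ∎))

    symm : ∀ x y → (x +ᴹ -ᴹ y) ∈ Mem N → (y +ᴹ -ᴹ x) ∈ Mem N
    symm x y h = resp (begin
      -ᴹ (x +ᴹ -ᴹ y)       ≈⟨ neg-+ x (-ᴹ y) ⟩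
      -ᴹ x +ᴹ -ᴹ (-ᴹ y)    ≈⟨ +ᴹ-congˡ (-ᴹ-involutive y) ⟩
      -ᴹ x +ᴹ y            ≈⟨ +ᴹ-comm (-ᴹ x) y ⟩
      y +ᴹ -ᴹ x ∎) (neg-mem h)

    tran : ∀ x y z → (x +ᴹ -ᴹ y) ∈ Mem N → (y +ᴹ -ᴹ z) ∈ Mem N →
           (x +ᴹ -ᴹ z) ∈ Mem N
    tran x y z h k = resp (begin
      (x +ᴹ -ᴹ y) +ᴹ (y +ᴹ -ᴹ z)    ≈⟨ +ᴹ-assoc x (-ᴹ y) (y +ᴹ -ᴹ z) ⟩
      x +ᴹ (-ᴹ y +ᴹ (y +ᴹ -ᴹ z))    ≈⟨ +ᴹ-congˡ (+ᴹ-assoc (-ᴹ y) y (-ᴹ z)) ⟨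
      x +ᴹ ((-ᴹ y +ᴹ y) +ᴹ -ᴹ z)    ≈⟨ +ᴹ-congˡ (+ᴹ-congʳ (-ᴹ‿inverseˡ y)) ⟩
      x +ᴹ (0ᴹ +ᴹ -ᴹ z)             ≈⟨ +ᴹ-congˡ (+ᴹ-identityˡ (-ᴹ z)) ⟩
      x +ᴹ -ᴹ z ∎) (+-mem h k)

    cong+ : ∀ x y u v → (x +ᴹ -ᴹ y) ∈ Mem N → (u +ᴹ -ᴹ v) ∈ Mem N →
            ((x +ᴹ u) +ᴹ -ᴹ (y +ᴹ v)) ∈ Mem N
    cong+ x y u v h k = resp (begin
      (x +ᴹ -ᴹ y) +ᴹ (u +ᴹ -ᴹ v)    ≈⟨ interchange x (-ᴹ y) u (-ᴹ v) ⟩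
      (x +ᴹ u) +ᴹ (-ᴹ y +ᴹ -ᴹ v)    ≈⟨ +ᴹ-congˡ (neg-+ y v) ⟨
      (x +ᴹ u) +ᴹ -ᴹ (y +ᴹ v) ∎) (+-mem h k)

    cong- : ∀ x y → (x +ᴹ -ᴹ y) ∈ Mem N → (-ᴹ x +ᴹ -ᴹ (-ᴹ y)) ∈ Mem N
    cong- x y h = resp (neg-+ x (-ᴹ y)) (neg-mem h)

    *-neg : ∀ r y → r *ₗ (-ᴹ y) ≈ᴹ -ᴹ (r *ₗ y)
    *-neg r y = inverseʳ-uniqueᴹ (r *ₗ y) (r *ₗ (-ᴹ y)) (begin
      r *ₗ y +ᴹ r *ₗ (-ᴹ y)    ≈⟨ *ₗ-distribˡ r y (-ᴹ y) ⟨
      r *ₗ (y +ᴹ -ᴹ y)         ≈⟨ *ₗ-congˡ (-ᴹ‿inverseʳ y) ⟩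
      r *ₗ 0ᴹ                  ≈⟨ *ₗ-zeroʳ r ⟩
      0ᴹ ∎)

    cong* : ∀ r s x y → r ≈ s → (x +ᴹ -ᴹ y) ∈ Mem N →
            ((r *ₗ x) +ᴹ -ᴹ (s *ₗ y)) ∈ Mem N
    cong* r s x y r≈s h = resp (begin
      r *ₗ (x +ᴹ -ᴹ y)           ≈⟨ *ₗ-distribˡ r x (-ᴹ y) ⟩
      r *ₗ x +ᴹ r *ₗ (-ᴹ y)      ≈⟨ +ᴹ-congˡ (*-neg r y) ⟩
      r *ₗ x +ᴹ -ᴹ (r *ₗ y)      ≈⟨ +ᴹ-congˡ (-ᴹ‿cong (*ₗ-congʳ r≈s)) ⟩
      r *ₗ x +ᴹ -ᴹ (s *ₗ y) ∎) (*-mem r h)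

  data Span (M : LeftModule ring m ℓm) (S : Pred (LeftModule.Carrierᴹ M) p) :
            Pred (LeftModule.Carrierᴹ M) (c ⊔ m ⊔ ℓm ⊔ p) where
    gen  : ∀ {x} → x ∈ S → x ∈ Span M S
    resp : ∀ {x y} → LeftModule._≈ᴹ_ M x y → x ∈ Span M S → y ∈ Span M S
    null : LeftModule.0ᴹ M ∈ Span M S
    add  : ∀ {x y} → x ∈ Span M S → y ∈ Span M S → LeftModule._+ᴹ_ M x y ∈ Span M S
    mul  : ∀ r {x} → x ∈ Span M S → LeftModule._*ₗ_ M r x ∈ Span M S

  span : (M : LeftModule ring m ℓm) → Pred (LeftModule.Carrierᴹ M) p →
         Submodule M (c ⊔ m ⊔ ℓm ⊔ p)
  span M S = record
    { Mem = Span M S ; resp = resp ; 0-mem = null ; +-mem = add ; *-mem = mul }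

  IsTorsion : LeftModule ring m ℓm → Set (c ⊔ ℓ ⊔ m ⊔ ℓm)
  IsTorsion M = ∀ x → ∃[ r ] r ≉ 0# × (r *ₗ x) ≈ᴹ 0ᴹ
    where open LeftModule M

  LinearlyIndependent : (M : LeftModule ring m ℓm) → ∀ {n} →
                        Vector (LeftModule.Carrierᴹ M) n → Set (c ⊔ ℓ ⊔ ℓm)
  LinearlyIndependent M {n} v =
    ∀ (r : Vector Carrier n) → sumᴹ (λ i → r i *ₗ v i) ≈ᴹ 0ᴹ → ∀ i → r i ≈ 0#
    where
    open LeftModule M
    open RawMonoidDefs (Monoid.rawMonoid +ᴹ-monoid) using () renaming (sum to sumᴹ)

  HasRank : {M : LeftModule ring m ℓm} → Submodule M p → ℕ → Set (c ⊔ ℓ ⊔ m ⊔ ℓm ⊔ p)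
  HasRank {M = M} N n = Σ[ v ∈ Vector (LeftModule.Carrierᴹ M) n ]
    (∀ i → v i ∈ Mem N) ×
    LinearlyIndependent M v ×
    (∀ x → x ∈ Mem N → ¬ LinearlyIndependent M (x Vector.∷ v))

  ⨁ : ∀ {r} → Vector (LeftModule ring m ℓm) r → LeftModule ring m ℓm
  ⨁ = Vector.foldr DirectProduct.leftModule Zero.leftModule

  𝒪 : LeftModule ring c ℓ
  𝒪 = TensorUnit.leftModule

  Ideal : Set (lsuc (c ⊔ ℓ))
  Ideal = Submodule 𝒪 (c ⊔ ℓ)

  unitIdeal : Ideal
  unitIdeal = record
    { Mem = λ _ → Unit.⊤ ; resp = λ _ _ → Unit.tt ; 0-mem = Unit.tt
    ; +-mem = λ _ _ → Unit.tt ; *-mem = λ _ _ → Unit.tt }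

  IsNonzero : Ideal → Set (c ⊔ ℓ)
  IsNonzero I = ¬ (∀ {x} → x ∈ Mem I → x ≈ 0#)

  ⟨_⟩ : Carrier → Ideal
  ⟨ b ⟩ = record
    { Mem = λ x → ∃[ q ] x ≈ q * b
    ; resp = λ x≈y (q , e) → q , trans (sym x≈y) e
    ; 0-mem = 0# , sym (zeroˡ b)
    ; +-mem = λ (q , e) (q′ , e′) →
        q + q′ , trans (+-cong e e′) (sym (distribʳ b q q′))
    ; *-mem = λ r (q , e) → r * q , trans (*-congˡ e) (sym (*-assoc r q b)) }

  infixl 6 _+ᴵ_
  infixl 7 _·_
  infixr 8 _^ᴵ_

  _+ᴵ_ : Ideal → Ideal → Ideal
  I +ᴵ J = record
    { Mem = λ x → ∃[ u ] ∃[ v ] u ∈ Mem I × v ∈ Mem J × x ≈ u + v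
    ; resp = λ x≈y (u , v , u∈ , v∈ , e) → u , v , u∈ , v∈ , trans (sym x≈y) e
    ; 0-mem = 0# , 0# , I.0-mem , J.0-mem , sym (+-identityˡ 0#)
    ; +-mem = λ (u , v , u∈ , v∈ , e) (u′ , v′ , u′∈ , v′∈ , e′) →
        u + u′ , v + v′ , I.+-mem u∈ u′∈ , J.+-mem v∈ v′∈ ,
        trans (+-cong e e′) (interchange u v u′ v′)
    ; *-mem = λ r (u , v , u∈ , v∈ , e) →
        r * u , r * v , I.*-mem r u∈ , J.*-mem r v∈ ,
        trans (*-congˡ e) (distribˡ r u v) }
    where
    module I = Submodule I
    module J = Submodule J
    open CommutativeSemigroupProperties +-commutativeSemigroup using (interchange)

  _·_ : Ideal → Ideal → Ideal
  I · J = span 𝒪 (λ x → ∃[ u ] ∃[ v ] u ∈ Mem I × v ∈ Mem J × x ≈ u * v)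

  _^ᴵ_ : Ideal → ℕ → Ideal
  I ^ᴵ zero  = unitIdeal
  I ^ᴵ suc n = I · (I ^ᴵ n)

  ∏ : ∀ {r} → Vector Ideal r → Ideal
  ∏ = Vector.foldr _·_ unitIdeal

  IsFinitelyGenerated : Ideal → Set (c ⊔ ℓ)
  IsFinitelyGenerated I =
    ∃[ n ] Σ[ g ∈ Vector Carrier n ] I ≈ˢ span 𝒪 (λ x → ∃[ i ] x ≈ g i)

  record IsPrime (P : Ideal) : Set (c ⊔ ℓ) where
    field
      proper : ¬ (P ≈ˢ unitIdeal)
      split  : ∀ {x y} → (x * y) ∈ Mem P → x ∈ Mem P ⊎ y ∈ Mem P

  record IsMaximal (P : Ideal) : Set (lsuc (c ⊔ ℓ)) where
    field
      proper  : ¬ (P ≈ˢ unitIdeal)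
      maximal : ∀ (J : Ideal) → P ⊆ˢ J → J ≈ˢ P ⊎ J ≈ˢ unitIdeal

  -- Fraction-free form of "a fraction a / b that is integral over O lies in
  -- O": the equation (a/b)ⁿ + Σ_{i<n} sᵢ (a/b)ⁱ = 0 has been multiplied by bⁿ.
  IsIntegrallyClosed : Set (c ⊔ ℓ)
  IsIntegrallyClosed = ∀ a b → b ≉ 0# → ∀ n (s : Vector Carrier n) →
    a ^ n + sum (λ i → s i * (a ^ toℕ i * b ^ (n ∸ toℕ i))) ≈ 0# → b ∣ a

  -- Fields are included.
  record IsDedekindDomain : Set (lsuc (c ⊔ ℓ)) where
    field
      1≉0                 : 1# ≉ 0#
      noZeroDivisors      : ∀ {x y} → x * y ≈ 0# → x ≈ 0# ⊎ y ≈ 0#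
      noetherian          : ∀ (I : Ideal) → IsFinitelyGenerated I
      integrallyClosed    : IsIntegrallyClosed
      nonzeroPrimeMaximal : ∀ (P : Ideal) → IsNonzero P → IsPrime P → IsMaximal P

  𝒪² : LeftModule ring c ℓ
  𝒪² = DirectProduct.leftModule 𝒪 𝒪

  record HasInvariantFactors (M : Submodule 𝒪² (c ⊔ ℓ)) (L K : Ideal) :
                             Set (lsuc (c ⊔ ℓ)) where
    field
      r          : ℕ
      𝔪          : Vector Ideal r
      𝔪-maximal  : ∀ i → IsMaximal (𝔪 i)
      𝔪-distinct : ∀ {i j} → i ≢ j → ¬ (𝔪 i ≈ˢ 𝔪 j)
      l k        : Vector ℕ r
      l≤k        : ∀ i → l i ℕ.≤ k i
      k≢0        : ∀ i → k i ≢ 0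
      quotient-≅ : 𝒪² / M ≅
        ⨁ (λ i → DirectProduct.leftModule (𝒪 / 𝔪 i ^ᴵ l i) (𝒪 / 𝔪 i ^ᴵ k i))
      L-factors  : L ≈ˢ ∏ (λ i → 𝔪 i ^ᴵ l i)
      K-factors  : K ≈ˢ ∏ (λ i → 𝔪 i ^ᴵ k i)

  record CotorsionSubmodule (L K : Ideal) : Set (lsuc (c ⊔ ℓ)) where
    field
      submodule        : Submodule 𝒪² (c ⊔ ℓ)
      cotorsion        : IsTorsion (𝒪² / submodule)
      rankTwo          : HasRank submodule 2
      invariantFactors : HasInvariantFactors submodule L K

  CotorsionSubmodules : Ideal → Ideal → Setoid (lsuc (c ⊔ ℓ)) (c ⊔ ℓ)
  CotorsionSubmodules L K = record
    { Carrier = CotorsionSubmodule L K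
    ; _≈_ = λ M N → submodule M ≈ˢ submodule N
    ; isEquivalence = record
      { refl = ≐-refl ; sym = ≐-sym ; trans = ≐-trans } }
    where open CotorsionSubmodule

  Unimodular : Set (c ⊔ ℓ)
  Unimodular = Σ[ (a , b) ∈ Carrier × Carrier ] (⟨ a ⟩ +ᴵ ⟨ b ⟩) ≈ˢ unitIdeal

  PF¹ : Ideal → Setoid (c ⊔ ℓ) (c ⊔ ℓ)
  PF¹ I = record
    { Carrier = Unimodular
    ; _≈_ = λ ((a , b) , _) ((a′ , b′) , _) → (a * b′ - b * a′) ∈ Mem I
    ; isEquivalence = record
      { refl = λ {((a , b) , _)} →
          I.resp (sym (trans (+-congˡ (-‿cong (*-comm b a))) (-‿inverseʳ (a * b)))) I.0-mem
      ; sym = λ {((a , b) , _)} {((a′ , b′) , _)} h →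
          I.resp (swap a b a′ b′) (I.*-mem (- 1#) h)
      ; trans = λ {((a , b) , _)} {((a′ , b′) , u)} {((a″ , b″) , _)} h k →
          transitive a b a′ b′ a″ b″ (proj₂ u Unit.tt) h k } }
    where
    module I = Submodule I
    open DeterminantIdentities O using (swap; combine)

    transitive : ∀ a b a′ b′ a″ b″ → 1# ∈ Mem (⟨ a′ ⟩ +ᴵ ⟨ b′ ⟩) →
      (a * b′ - b * a′) ∈ Mem I → (a′ * b″ - b′ * a″) ∈ Mem I →
      (a * b″ - b * a″) ∈ Mem I
    transitive a b a′ b′ a″ b″ (u , v , (s , su) , (t , tv) , e) h k =
      I.resp
        (trans (combine s t a b a′ b′ a″ b″)
          (trans (*-congʳ (trans (+-cong (sym su) (sym tv)) (sym e))) (*-identityˡ _)))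
        (I.+-mem
          (I.*-mem s (I.+-mem (I.*-mem a k) (I.*-mem a″ h)))
          (I.*-mem t (I.+-mem (I.*-mem b″ h) (I.*-mem b k))))

module Submission where

-- A point (a : b) corresponds to the lattice of all (x , y) ∈ L² with
-- a y - b x ∈ K.  If u a + v b = 1, then (ξ , η) = (u x + v y , a y - b x) are
-- coordinates on 𝒪² in which this lattice is L ⊕ K, so the Chinese remainder
-- theorem gives its invariant factors.  Two points with the same lattice
-- satisfy t (a b′ - b a′) ∈ K = L I for all t ∈ L, and L cancels.
-- Conversely, let M be the kernel of a surjection (σ , τ) : 𝒪² → 𝒪/L ⊕ 𝒪/K.
-- Modulo L the matrix of (σ , τ) is invertible, so M = {z ∈ L² | τ z ∈ K}; the
-- coefficients of τ are unimodular modulo K and lift to a unimodular pair.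
-- The arithmetic of 𝒪 needed for this is classical.  It is available
-- constructively because finite generation of every ideal, taken as data,
-- entails excluded middle (em below).

open import Defs
open import Algebra.Bundles using (CommutativeMonoid; CommutativeRing; RawRing)
open import Algebra.Definitions.RawMagma using (_,_)
open import Algebra.Module.Bundles using (LeftModule)
open import Algebra.Module.Morphism.Structures using (IsLeftModuleIsomorphism)
import Algebra.Module.Construct.DirectProduct as DirectProduct
import Algebra.Properties.AbelianGroup as AbelianGroupProperties
import Algebra.Properties.CommutativeSemigroup as CommutativeSemigroupProperties
import Algebra.Properties.Ring as RingProperties
import Algebra.Properties.Semiring.Mult.TCOptimised as Mult
import Algebra.Properties.Semiring.Exp as Exp
import Algebra.Properties.Semiring.Sum as Sum
import Algebra.Solver.Ring as RingSolver
open import Algebra.Solver.Ring.AlmostCommutativeRing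
  using (fromCommutativeRing; _-Raw-AlmostCommutative⟶_)
open import Data.Empty using (⊥-elim)
open import Data.Fin.Base using (Fin; zero; suc; toℕ)
open import Data.Fin.Properties using (suc-injective; toℕ<n)
open import Data.Integer.Base as ℤ using (ℤ; -[1+_])
import Data.Integer.Properties as ℤ
open import Data.Maybe.Base using (Maybe; just; nothing)
open import Data.Nat.Base as ℕ using (ℕ; zero; suc; _∸_)
import Data.Nat.Properties as ℕ
open import Data.Product.Base using (Σ-syntax; ∃-syntax; _×_; _,_; proj₁; proj₂)
open import Data.Sum.Base using (_⊎_; inj₁; inj₂)
import Data.Sign.Base as Sign
import Data.Unit.Polymorphic.Base as Unit
open import Data.Vec.Functional as Vector using (Vector)
open import Function.Base using (_∘_)
open import Function.Bundles using (Inverse)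
open import Induction.WellFounded using (Acc; acc; WellFounded)
open import Level using (Level; _⊔_; Lift; lift) renaming (suc to lsuc)
open import Relation.Binary.Bundles using (Setoid)
open import Relation.Binary.PropositionalEquality.Core as ≡ using (_≡_; _≢_)
import Relation.Binary.Reasoning.Setoid as SetoidReasoning
open import Relation.Nullary.Decidable using (Dec; yes; no)
open import Relation.Nullary.Negation.Core using (¬_)
open import Relation.Unary using (Pred)
open import Relation.Unary.Properties using (≐-refl; ≐-sym; ≐-trans)

-- Cancelling `L`, factoring `L` and `K`, and lifting the coefficients of τ all rest on one fact:
-- nonzero ideals are invertible. It has to be derived from the three axioms noetherian, integrally
-- closed, and nonzero primes maximal. No field of fractions is formed. A fraction is a numerator
-- with a denominator, an inverse of I is an ideal J with I J = ⟨ e ⟩ and e nonzero, and division is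
-- an ideal quotient followed by cancellation of an element. Excluded middle is available at the
-- level of elements of 𝒪 but not for statements that quantify over all ideals. Searches therefore
-- run over elements or tuples of generators, recursion climbs through strictly larger ideals, and
-- prime factorisation is used as an induction principle I = P J. A submodule determines a single
-- point because σ drops out: once M is known to lie in L², the condition on σ holds by itself and
-- only τ is left. Its coefficients are unimodular modulo `K` because τ takes the value 1.

module IntegerCoefficients {c ℓ : Level} (O : CommutativeRing c ℓ) where

  open CommutativeRing O
  open RingProperties ring using (-‿distribˡ-*; -‿distribʳ-*; -0#≈0#; -‿involutive)
  open AbelianGroupProperties +-abelianGroup using (⁻¹-∙-comm)
  open Mult semiring using (×-homo-+; ×1-homo-*; 1+×) renaming (_×_ to infixl 8 _×ₙ_)
  open SetoidReasoning setoid

  -- The identities to be solved contain subtractions, so coefficients are taken in ℤ, where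
  -- cancellation is decidable. With the optimised multiple `_×ₙ_`, `⟦ ℤ.1ℤ ⟧` reduces to `1#`, so
  -- `con ℤ.1ℤ` matches `1#` in the goals.
  ⟦_⟧ : ℤ → Carrier
  ⟦ ℤ.+ n ⟧ = n ×ₙ 1#
  ⟦ -[1+ n ] ⟧ = - (suc n ×ₙ 1#)

  cancel-1 : ∀ x y → (1# + x) - (1# + y) ≈ x - y
  cancel-1 x y = begin
    (1# + x) - (1# + y)        ≈⟨ +-cong (+-comm 1# x) (sym (⁻¹-∙-comm 1# y)) ⟩
    (x + 1#) + (- 1# + - y)    ≈⟨ +-assoc x 1# _ ⟩
    x + (1# + (- 1# + - y))    ≈⟨ +-congˡ (sym (+-assoc 1# (- 1#) (- y))) ⟩
    x + ((1# - 1#) + - y)      ≈⟨ +-congˡ (trans (+-congʳ (-‿inverseʳ 1#)) (+-identityˡ _)) ⟩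
    x - y                      ∎

  ⊖-homo : ∀ m n → ⟦ m ℤ.⊖ n ⟧ ≈ m ×ₙ 1# - n ×ₙ 1#
  ⊖-homo zero zero = sym (-‿inverseʳ 0#)
  ⊖-homo zero (suc n) = sym (+-identityˡ _)
  ⊖-homo (suc m) zero = sym (trans (+-congˡ -0#≈0#) (+-identityʳ _))
  ⊖-homo (suc m) (suc n) = begin
    ⟦ suc m ℤ.⊖ suc n ⟧                ≡⟨ ≡.cong ⟦_⟧ (ℤ.[1+m]⊖[1+n]≡m⊖n m n) ⟩
    ⟦ m ℤ.⊖ n ⟧                        ≈⟨ ⊖-homo m n ⟩
    m ×ₙ 1# - n ×ₙ 1#                    ≈⟨ cancel-1 _ _ ⟨
    (1# + m ×ₙ 1#) - (1# + n ×ₙ 1#)      ≈⟨ +-cong (1+× m 1#) (-‿cong (1+× n 1#)) ⟨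
    suc m ×ₙ 1# - suc n ×ₙ 1#            ∎

  ⟦⟧-homo-+ : ∀ i j → ⟦ i ℤ.+ j ⟧ ≈ ⟦ i ⟧ + ⟦ j ⟧
  ⟦⟧-homo-+ (ℤ.+ m) (ℤ.+ n) = ×-homo-+ 1# m n
  ⟦⟧-homo-+ (ℤ.+ m) -[1+ n ] = ⊖-homo m (suc n)
  ⟦⟧-homo-+ -[1+ m ] (ℤ.+ n) = trans (⊖-homo n (suc m)) (+-comm _ _)
  ⟦⟧-homo-+ -[1+ m ] -[1+ n ] = begin
    - (suc (suc (m ℕ.+ n)) ×ₙ 1#)           ≡⟨ ≡.cong (λ k → - (k ×ₙ 1#)) (≡.cong suc (ℕ.+-suc m n)) ⟨
    - ((suc m ℕ.+ suc n) ×ₙ 1#)             ≈⟨ -‿cong (×-homo-+ 1# (suc m) (suc n)) ⟩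
    - (suc m ×ₙ 1# + suc n ×ₙ 1#)            ≈⟨ ⁻¹-∙-comm _ _ ⟨
    - (suc m ×ₙ 1#) - (suc n ×ₙ 1#)          ∎

  ⟦⟧-homo-neg : ∀ i → ⟦ ℤ.- i ⟧ ≈ - ⟦ i ⟧
  ⟦⟧-homo-neg (ℤ.+ zero) = sym -0#≈0#
  ⟦⟧-homo-neg (ℤ.+ suc n) = refl
  ⟦⟧-homo-neg -[1+ n ] = sym (-‿involutive _)

  ⟦⟧-homo-* : ∀ i j → ⟦ i ℤ.* j ⟧ ≈ ⟦ i ⟧ * ⟦ j ⟧
  ⟦⟧-homo-* (ℤ.+ m) (ℤ.+ n) =
    trans (reflexive (≡.cong ⟦_⟧ (≡.sym (ℤ.pos-* m n)))) (×1-homo-* m n)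
  ⟦⟧-homo-* (ℤ.+ m) -[1+ n ] = begin
    ⟦ Sign.- ℤ.◃ (m ℕ.* suc n) ⟧     ≡⟨ ≡.cong ⟦_⟧ (ℤ.-◃n≡-n (m ℕ.* suc n)) ⟩
    ⟦ ℤ.- (ℤ.+ (m ℕ.* suc n)) ⟧      ≈⟨ ⟦⟧-homo-neg (ℤ.+ (m ℕ.* suc n)) ⟩
    - ((m ℕ.* suc n) ×ₙ 1#)           ≈⟨ -‿cong (×1-homo-* m (suc n)) ⟩
    - (m ×ₙ 1# * (suc n ×ₙ 1#))        ≈⟨ -‿distribʳ-* _ _ ⟩
    m ×ₙ 1# * - (suc n ×ₙ 1#)          ∎
  ⟦⟧-homo-* -[1+ m ] (ℤ.+ n) = begin
    ⟦ Sign.- ℤ.◃ (suc m ℕ.* n) ⟧     ≡⟨ ≡.cong ⟦_⟧ (ℤ.-◃n≡-n (suc m ℕ.* n)) ⟩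
    ⟦ ℤ.- (ℤ.+ (suc m ℕ.* n)) ⟧      ≈⟨ ⟦⟧-homo-neg (ℤ.+ (suc m ℕ.* n)) ⟩
    - ((suc m ℕ.* n) ×ₙ 1#)           ≈⟨ -‿cong (×1-homo-* (suc m) n) ⟩
    - (suc m ×ₙ 1# * (n ×ₙ 1#))        ≈⟨ -‿distribˡ-* _ _ ⟩
    - (suc m ×ₙ 1#) * (n ×ₙ 1#)        ∎
  ⟦⟧-homo-* -[1+ m ] -[1+ n ] = begin
    (suc m ℕ.* suc n) ×ₙ 1#               ≈⟨ ×1-homo-* (suc m) (suc n) ⟩
    suc m ×ₙ 1# * (suc n ×ₙ 1#)            ≈⟨ -‿involutive _ ⟨
    - - (suc m ×ₙ 1# * (suc n ×ₙ 1#))      ≈⟨ -‿cong (-‿distribˡ-* _ _) ⟩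
    - (- (suc m ×ₙ 1#) * (suc n ×ₙ 1#))    ≈⟨ -‿distribʳ-* _ _ ⟩
    - (suc m ×ₙ 1#) * - (suc n ×ₙ 1#)      ∎

  ℤ-rawRing : RawRing _ _
  ℤ-rawRing = record
    { Carrier = ℤ ; _≈_ = _≡_ ; _+_ = ℤ._+_ ; _*_ = ℤ._*_ ; -_ = ℤ.-_
    ; 0# = ℤ.0ℤ ; 1# = ℤ.1ℤ }

  homomorphism : ℤ-rawRing -Raw-AlmostCommutative⟶ fromCommutativeRing O
  homomorphism = record
    { ⟦_⟧ = ⟦_⟧ ; +-homo = ⟦⟧-homo-+ ; *-homo = ⟦⟧-homo-* ; -‿homo = ⟦⟧-homo-neg
    ; 0-homo = refl ; 1-homo = refl }

  ≟⇒≈ : ∀ i j → Maybe (⟦ i ⟧ ≈ ⟦ j ⟧)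
  ≟⇒≈ i j with i ℤ.≟ j
  ... | yes i≡j = just (reflexive (≡.cong ⟦_⟧ i≡j))
  ... | no  _   = nothing

  open RingSolver ℤ-rawRing (fromCommutativeRing O) homomorphism ≟⇒≈ public
    using (solve; _:+_; _:*_; _:-_; :-_; _:=_; con)

-- Products, quotients and comaximality of ideals.

module IdealArithmetic {c ℓ : Level} (O : CommutativeRing c ℓ) where

  open CommutativeRing O hiding (zero)
  open OverRing O
  open IntegerCoefficients O using (solve; _:+_; _:*_; _:-_; :-_; _:=_; con)
  open Submodule using () renaming (resp to ∈-resp; 0-mem to 0∈; +-mem to ∈-+; *-mem to ∈-*)

  -‿mem : (I : Ideal) → ∀ {x} → Mem I x → Mem I (- x)
  -‿mem I {x} x∈ = ∈-resp I (RingProperties.-1*x≈-x ring x) (∈-* I (- 1#) x∈)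

  ∈-*ʳ : (I : Ideal) → ∀ {x} r → Mem I x → Mem I (x * r)
  ∈-*ʳ I r x∈ = ∈-resp I (*-comm _ _) (∈-* I r x∈)

  1∈⇒unit : (I : Ideal) → Mem I 1# → I ≈ˢ unitIdeal
  1∈⇒unit I 1∈ = (λ _ → Unit.tt) , λ {x} _ → ∈-resp I (*-identityʳ x) (∈-* I x 1∈)

  span-least : ∀ {p} {S : Pred Carrier p} (N : Ideal) → (∀ {x} → S x → Mem N x) →
               ∀ {x} → Span 𝒪 S x → Mem N x
  span-least N S⊆N (gen x∈) = S⊆N x∈
  span-least N S⊆N (resp x≈y x∈) = ∈-resp N x≈y (span-least N S⊆N x∈)
  span-least N S⊆N null = 0∈ N
  span-least N S⊆N (add x∈ y∈) = ∈-+ N (span-least N S⊆N x∈) (span-least N S⊆N y∈)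
  span-least N S⊆N (mul r x∈) = ∈-* N r (span-least N S⊆N x∈)

  infixl 7 _∶_

  -- The ideal quotient (I : v). It also turns a claim about multiples of a fixed v into membership
  -- in an ideal, so that `·-least` can prove the claim on generators of a product.
  _∶_ : Ideal → Carrier → Ideal
  I ∶ v = record
    { Mem = λ x → Mem I (x * v)
    ; resp = λ x≈y → ∈-resp I (*-congʳ x≈y)
    ; 0-mem = ∈-resp I (sym (zeroˡ v)) (0∈ I)
    ; +-mem = λ x∈ y∈ → ∈-resp I (sym (distribʳ v _ _)) (∈-+ I x∈ y∈)
    ; *-mem = λ r x∈ → ∈-resp I (sym (*-assoc r _ v)) (∈-* I r x∈) }

  +ᴵ-inˡ : (I J : Ideal) → I ⊆ˢ I +ᴵ J
  +ᴵ-inˡ I J {x} x∈ = x , 0# , x∈ , 0∈ J , sym (+-identityʳ x)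

  +ᴵ-inʳ : (I J : Ideal) → J ⊆ˢ I +ᴵ J
  +ᴵ-inʳ I J {x} x∈ = 0# , x , 0∈ I , x∈ , sym (+-identityˡ x)

  +ᴵ-least : (I J N : Ideal) → I ⊆ˢ N → J ⊆ˢ N → I +ᴵ J ⊆ˢ N
  +ᴵ-least I J N I⊆N J⊆N (u , v , u∈ , v∈ , e) = ∈-resp N (sym e) (∈-+ N (I⊆N u∈) (J⊆N v∈))

  ⟨⟩-mem : ∀ x → Mem ⟨ x ⟩ x
  ⟨⟩-mem x = 1# , sym (*-identityˡ x)

  ⟨⟩-least : (N : Ideal) → ∀ {x} → Mem N x → ⟨ x ⟩ ⊆ˢ N
  ⟨⟩-least N x∈ (q , e) = ∈-resp N (sym e) (∈-* N q x∈)

  ·-mem : (I J : Ideal) → ∀ {u v} → Mem I u → Mem J v → Mem (I · J) (u * v)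
  ·-mem I J u∈ v∈ = gen (_ , _ , u∈ , v∈ , refl)

  ·-least : (I J N : Ideal) → (∀ {u v} → Mem I u → Mem J v → Mem N (u * v)) → I · J ⊆ˢ N
  ·-least I J N h = span-least N λ (u , v , u∈ , v∈ , e) → ∈-resp N (sym e) (h u∈ v∈)

  ·-mono : (I I′ J J′ : Ideal) → I ⊆ˢ I′ → J ⊆ˢ J′ → I · J ⊆ˢ I′ · J′
  ·-mono I I′ J J′ I⊆ J⊆ = ·-least I J (I′ · J′) λ u∈ v∈ → ·-mem I′ J′ (I⊆ u∈) (J⊆ v∈)

  ·-⊆ˡ : (I J : Ideal) → I · J ⊆ˢ I
  ·-⊆ˡ I J = ·-least I J I λ u∈ v∈ → ∈-*ʳ I _ u∈

  ·-⊆ʳ : (I J : Ideal) → I · J ⊆ˢ J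
  ·-⊆ʳ I J = ·-least I J J λ u∈ v∈ → ∈-* J _ v∈

  ·-comm-⊆ : (I J : Ideal) → I · J ⊆ˢ J · I
  ·-comm-⊆ I J = ·-least I J (J · I) λ u∈ v∈ → resp (*-comm _ _) (·-mem J I v∈ u∈)

  ·-assoc-⊆ : (I J K : Ideal) → (I · J) · K ⊆ˢ I · (J · K)
  ·-assoc-⊆ I J K = ·-least (I · J) K (I · (J · K)) λ {_} {v} w∈ v∈ →
    ·-least I J ((I · (J · K)) ∶ v)
      (λ x∈ y∈ → resp (sym (*-assoc _ _ v)) (·-mem I (J · K) x∈ (·-mem J K y∈ v∈))) w∈

  ·-assoc-⊇ : (I J K : Ideal) → I · (J · K) ⊆ˢ (I · J) · K
  ·-assoc-⊇ I J K x∈ = ·-comm-⊆ K (I · J) (·-mono K K (J · I) (I · J) (λ y → y) (·-comm-⊆ J I)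
    (·-assoc-⊆ K J I (·-mono (J · K) (K · J) I I (·-comm-⊆ J K) (λ y → y)
      (·-comm-⊆ I (J · K) x∈))))

  ·-identityˡ : (I : Ideal) → unitIdeal · I ≈ˢ I
  ·-identityˡ I = ·-⊆ʳ unitIdeal I , λ {x} x∈ →
    resp (*-identityˡ x) (·-mem unitIdeal I Unit.tt x∈)

  ·-commutativeMonoid : CommutativeMonoid (lsuc (c ⊔ ℓ)) (c ⊔ ℓ)
  ·-commutativeMonoid = record
    { Carrier = Ideal ; _≈_ = _≈ˢ_ ; _∙_ = _·_ ; ε = unitIdeal
    ; isCommutativeMonoid = record
      { isMonoid = record
        { isSemigroup = record
          { isMagma = record
            { isEquivalence = record { refl = ≐-refl ; sym = ≐-sym ; trans = ≐-trans }
            ; ∙-cong = λ {I} {I′} {J} {J′} I≈ J≈ →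
                ·-mono I I′ J J′ (proj₁ I≈) (proj₁ J≈) , ·-mono I′ I J′ J (proj₂ I≈) (proj₂ J≈) }
          ; assoc = λ I J K → ·-assoc-⊆ I J K , ·-assoc-⊇ I J K }
        ; identity = ·-identityˡ , λ I →
            ≐-trans (·-comm-⊆ I unitIdeal , ·-comm-⊆ unitIdeal I) (·-identityˡ I) }
      ; comm = λ I J → ·-comm-⊆ I J , ·-comm-⊆ J I } }

  private
    module ·-Properties = CommutativeMonoid ·-commutativeMonoid

  open CommutativeSemigroupProperties ·-Properties.commutativeSemigroup public
    using () renaming (x∙yz≈y∙xz to ·-swapˡ)
  open ·-Properties public
    using ()
    renaming ( assoc to ·-assoc; ∙-cong to ·-cong; ∙-congˡ to ·-congˡ; ∙-congʳ to ·-congʳ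
             ; identityʳ to ·-identityʳ )

  ^ᴵ-+ : (I : Ideal) → ∀ m n → I ^ᴵ (m ℕ.+ n) ≈ˢ I ^ᴵ m · I ^ᴵ n
  ^ᴵ-+ I zero n = ≐-sym (·-identityˡ (I ^ᴵ n))
  ^ᴵ-+ I (suc m) n = ≐-trans (·-congˡ {I} {I ^ᴵ (m ℕ.+ n)} {I ^ᴵ m · I ^ᴵ n} (^ᴵ-+ I m n))
    (≐-sym (·-assoc I (I ^ᴵ m) (I ^ᴵ n)))

  Comaximal : Ideal → Ideal → Set (c ⊔ ℓ)
  Comaximal I J = Mem (I +ᴵ J) 1#

  comaximal-mono : (I I′ J J′ : Ideal) → I ⊆ˢ I′ → J ⊆ˢ J′ → Comaximal I J → Comaximal I′ J′
  comaximal-mono I I′ J J′ I⊆ J⊆ (u , v , u∈ , v∈ , e) = u , v , I⊆ u∈ , J⊆ v∈ , e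

  comaximal-sym : (I J : Ideal) → Comaximal I J → Comaximal J I
  comaximal-sym I J (u , v , u∈ , v∈ , e) = v , u , v∈ , u∈ , trans e (+-comm u v)

  comaximal-unit : (I : Ideal) → Comaximal I unitIdeal
  comaximal-unit I = +ᴵ-inʳ I unitIdeal Unit.tt

  comaximal-· : (I J K : Ideal) → Comaximal I J → Comaximal I K → Comaximal I (J · K)
  comaximal-· I J K (u , v , u∈ , v∈ , e) (u′ , v′ , u′∈ , v′∈ , e′) =
    u * (u′ + v′) + u′ * v , v * v′ ,
    ∈-+ I (∈-*ʳ I _ u∈) (∈-*ʳ I v u′∈) , ·-mem J K v∈ v′∈ ,
    trans (sym (*-identityˡ 1#)) (trans (*-cong e e′)
      (solve 4 (λ u v u′ v′ → (u :+ v) :* (u′ :+ v′) := (u :* (u′ :+ v′) :+ u′ :* v) :+ v :* v′)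
        refl u v u′ v′))

  comaximal-^ : (I J : Ideal) → Comaximal I J → ∀ n → Comaximal I (J ^ᴵ n)
  comaximal-^ I J co zero = comaximal-unit I
  comaximal-^ I J co (suc n) = comaximal-· I J (J ^ᴵ n) co (comaximal-^ I J co n)

  comaximal-∏ : (I : Ideal) → ∀ {r} (A : Vector Ideal r) → (∀ i → Comaximal I (A i)) →
                Comaximal I (∏ A)
  comaximal-∏ I {zero} A co = comaximal-unit I
  comaximal-∏ I {suc r} A co = comaximal-· I (A zero) (∏ (A ∘ suc)) (co zero)
    (comaximal-∏ I (A ∘ suc) (co ∘ suc))

  comaximal-∩ : (I J : Ideal) → Comaximal I J → ∀ {x} → Mem I x → Mem J x → Mem (I · J) x
  comaximal-∩ I J (u , v , u∈ , v∈ , e) {x} x∈I x∈J = resp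
    (trans (solve 3 (λ u v x → u :* x :+ x :* v := x :* (u :+ v)) refl u v x)
      (trans (*-congˡ (sym e)) (*-identityʳ x)))
    (add (·-mem I J u∈ x∈J) (·-mem I J x∈I v∈))

  maximal-comaximal : (P : Ideal) → IsMaximal P → ∀ {x} → ¬ Mem P x → Comaximal P ⟨ x ⟩
  maximal-comaximal P P-max {x} x∉
    with IsMaximal.maximal P-max (P +ᴵ ⟨ x ⟩) (+ᴵ-inˡ P ⟨ x ⟩)
  ... | inj₁ (P+x⊆P , _) = ⊥-elim (x∉ (P+x⊆P (+ᴵ-inʳ P ⟨ x ⟩ (⟨⟩-mem x))))
  ... | inj₂ (_ , ⊤⊆P+x) = ⊤⊆P+x Unit.tt

  maximal-∌1 : (P : Ideal) → IsMaximal P → ¬ Mem P 1#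
  maximal-∌1 P P-max 1∈ = IsMaximal.proper P-max (1∈⇒unit P 1∈)

  -- Multiply an equation 1 = u + q x, with u in P, by y: both u y and q (x y) would lie in P.
  maximal-*∉ : (P : Ideal) → IsMaximal P → ∀ {x y} → ¬ Mem P x → ¬ Mem P y → ¬ Mem P (x * y)
  maximal-*∉ P P-max {x} {y} x∉ y∉ xy∈ with maximal-comaximal P P-max x∉
  ... | u , v , u∈ , (q , v≈qx) , e = y∉ (∈-resp P
    (trans (solve 4 (λ u q x y → u :* y :+ q :* (x :* y) := (u :+ q :* x) :* y) refl u q x y)
      (trans (*-congʳ (trans (+-congˡ (sym v≈qx)) (sym e))) (*-identityˡ y)))
    (∈-+ P (∈-*ʳ P y u∈) (∈-* P q xy∈)))

-- Excluded middle and noetherian recursion.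

module Dedekind {c ℓ : Level} (O : CommutativeRing c ℓ)
                (isDedekind : OverRing.IsDedekindDomain O) where

  open CommutativeRing O hiding (zero)
  open OverRing O
  open IsDedekindDomain isDedekind
  open IntegerCoefficients O using (solve; _:+_; _:*_; _:-_; :-_; _:=_; con)
  open IdealArithmetic O
  open Submodule using () renaming (resp to ∈-resp; 0-mem to 0∈; +-mem to ∈-+; *-mem to ∈-*)
  open Exp semiring using (_^_; ^-homo-*; ^-congʳ)
  open Sum semiring using (sum; *-distribˡ-sum; sum-cong-≋)

  -- {x | x ≈ 0 or A} is an ideal; each of its finitely many generators
  -- either vanishes or proves A.
  em : (A : Set (c ⊔ ℓ)) → Dec A
  em A = decide (noetherian I)
    where
    I : Ideal
    I = record
      { Mem = λ x → x ≈ 0# ⊎ A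
      ; resp = λ where
          x≈y (inj₁ x≈0) → inj₁ (trans (sym x≈y) x≈0)
          x≈y (inj₂ a) → inj₂ a
      ; 0-mem = inj₁ refl
      ; +-mem = λ where
          (inj₁ x≈0) (inj₁ y≈0) → inj₁ (trans (+-cong x≈0 y≈0) (+-identityʳ 0#))
          (inj₁ x≈0) (inj₂ a) → inj₂ a
          (inj₂ a) _ → inj₂ a
      ; *-mem = λ where
          r (inj₁ x≈0) → inj₁ (trans (*-congˡ x≈0) (zeroʳ r))
          r (inj₂ a) → inj₂ a }

    all-or : ∀ {n} {P : Fin n → Set ℓ} → (∀ i → P i ⊎ A) → (∀ i → P i) ⊎ A
    all-or {zero} f = inj₁ λ ()
    all-or {suc n} f with f zero | all-or (f ∘ suc)
    ... | inj₂ a | _ = inj₂ a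
    ... | inj₁ _ | inj₂ a = inj₂ a
    ... | inj₁ p | inj₁ ps = inj₁ λ { zero → p ; (suc i) → ps i }

    decide : IsFinitelyGenerated I → Dec A
    decide (n , g , I⊆ , ⊆I) with all-or (λ i → ⊆I (gen (i , refl)))
    ... | inj₂ a = yes a
    ... | inj₁ g≈0 = no λ a →
      let q , 1≈q0 = span-least ⟨ 0# ⟩
                       (λ (i , x≈g) → 0# , trans x≈g (trans (g≈0 i) (sym (zeroʳ 0#))))
                       (I⊆ (inj₂ a))
      in 1≉0 (trans 1≈q0 (zeroʳ q))

  _≟0 : ∀ x → Dec (x ≈ 0#)
  x ≟0 with em (Lift c (x ≈ 0#))
  ... | yes (lift x≈0) = yes x≈0
  ... | no x≉0 = no (x≉0 ∘ lift)

  *-≉0 : ∀ {x y} → x ≉ 0# → y ≉ 0# → x * y ≉ 0#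
  *-≉0 x≉0 y≉0 xy≈0 with noZeroDivisors xy≈0
  ... | inj₁ x≈0 = x≉0 x≈0
  ... | inj₂ y≈0 = y≉0 y≈0

  *-cancelˡ : ∀ {x y z} → x ≉ 0# → x * y ≈ x * z → y ≈ z
  *-cancelˡ {x} {y} {z} x≉0 xy≈xz
    with noZeroDivisors {x} {y - z}
      (trans (solve 3 (λ x y z → x :* (y :- z) := x :* y :- x :* z) refl x y z)
        (trans (+-congʳ xy≈xz) (-‿inverseʳ (x * z))))
  ... | inj₁ x≈0 = ⊥-elim (x≉0 x≈0)
  ... | inj₂ y-z≈0 = trans (solve 2 (λ y z → y := (y :- z) :+ z) refl y z)
    (trans (+-congʳ y-z≈0) (+-identityˡ z))

  ⊈⇒∃ : (I J : Ideal) → ¬ (I ⊆ˢ J) → ∃[ x ] Mem I x × ¬ Mem J x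
  ⊈⇒∃ I J I⊈J with em (∃[ x ] Mem I x × ¬ Mem J x)
  ... | yes w = w
  ... | no ∄ = ⊥-elim (I⊈J λ {x} x∈I → stable x x∈I)
    where
    stable : ∀ x → Mem I x → Mem J x
    stable x x∈I with em (Mem J x)
    ... | yes x∈J = x∈J
    ... | no x∉J = ⊥-elim (∄ (x , x∈I , x∉J))

  nonzero-element : (I : Ideal) → IsNonzero I → ∃[ x ] Mem I x × x ≉ 0#
  nonzero-element I I≠0 with em (∃[ x ] Mem I x × x ≉ 0#)
  ... | yes w = w
  ... | no ∄ = ⊥-elim (I≠0 λ {x} x∈I → stable x x∈I)
    where
    stable : ∀ x → Mem I x → x ≈ 0#
    stable x x∈I with x ≟0
    ... | yes x≈0 = x≈0
    ... | no x≉0 = ⊥-elim (∄ (x , x∈I , x≉0))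

  ∋⇒nonzero : (I : Ideal) → ∀ {x} → Mem I x → x ≉ 0# → IsNonzero I
  ∋⇒nonzero I x∈ x≉0 I⊆0 = x≉0 (I⊆0 x∈)

  nonzero-mono : (I J : Ideal) → I ⊆ˢ J → IsNonzero I → IsNonzero J
  nonzero-mono I J I⊆J I≠0 J⊆0 = I≠0 λ x∈ → J⊆0 (I⊆J x∈)

  module AscendingChain (F : ℕ → Ideal) (F-step : ∀ n → F n ⊆ˢ F (suc n)) where

    F-mono : ∀ k n → F n ⊆ˢ F (k ℕ.+ n)
    F-mono zero n x∈ = x∈
    F-mono (suc k) n x∈ = F-step (k ℕ.+ n) (F-mono k n x∈)

    F-monoˡ : ∀ m n → F m ⊆ˢ F (m ℕ.+ n)
    F-monoˡ m n {x} x∈ = ≡.subst (λ k → Mem (F k) x) (ℕ.+-comm n m) (F-mono n m x∈)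

    union : Ideal
    union = record
      { Mem = λ x → ∃[ n ] Mem (F n) x
      ; resp = λ x≈y (n , x∈) → n , ∈-resp (F n) x≈y x∈
      ; 0-mem = 0 , 0∈ (F 0)
      ; +-mem = λ (m , x∈) (n , y∈) →
          m ℕ.+ n , ∈-+ (F (m ℕ.+ n)) (F-monoˡ m n x∈) (F-mono m n y∈)
      ; *-mem = λ r (n , x∈) → n , ∈-* (F n) r x∈ }

    bounded : ∀ {k} (g : Vector Carrier k) → (∀ i → Mem union (g i)) →
              ∃[ n ] (∀ i → Mem (F n) (g i))
    bounded {zero} g g∈ = 0 , λ ()
    bounded {suc k} g g∈ with g∈ zero | bounded (g ∘ suc) (g∈ ∘ suc)
    ... | m , g₀∈ | n , gs∈ = m ℕ.+ n , λ where
      zero → F-monoˡ m n g₀∈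
      (suc i) → F-mono m n (gs∈ i)

    -- The union of the chain has finitely many generators, and all of them have appeared by some
    -- stage n.
    stabilises : ∃[ n ] F (suc n) ⊆ˢ F n
    stabilises with noetherian union
    ... | k , g , U⊆ , ⊆U with bounded g (λ i → ⊆U (gen (i , refl)))
    ... | n , g∈ = n , λ x∈ →
      span-least (F n) (λ (i , x≈g) → ∈-resp (F n) (sym x≈g) (g∈ i)) (U⊆ (suc n , x∈))

  infix 4 _⊏_

  -- The larger ideal is the smaller element, so that the ascending chain condition becomes
  -- well-foundedness and recursion climbs.
  _⊏_ : Ideal → Ideal → Set (c ⊔ ℓ)
  J ⊏ I = I ⊆ˢ J × ¬ (J ⊆ˢ I)

  -- Accessibility of an ideal lives in a universe too large for em, so the
  -- ideals are first replaced by tuples of generators.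
  private
    Tuple : Set c
    Tuple = ∃[ n ] Vector Carrier n

    generated : Tuple → Ideal
    generated (n , g) = span 𝒪 (λ x → ∃[ i ] x ≈ g i)

    _⊏ᵗ_ : Tuple → Tuple → Set (c ⊔ ℓ)
    h ⊏ᵗ g = generated h ⊏ generated g

    -- A tuple that is not accessible lies below a strictly larger ideal whose tuple is not
    -- accessible either. Choosing such tuples repeatedly would give a strictly ascending chain.
    ⊏ᵗ-wellFounded : WellFounded _⊏ᵗ_
    ⊏ᵗ-wellFounded g with em (Acc _⊏ᵗ_ g)
    ... | yes g-acc = g-acc
    ... | no g-¬acc =
      let n , F⊆ = AscendingChain.stabilises F F-step in ⊥-elim (F-strict n F⊆)
      where
      next : ∀ g → ¬ Acc _⊏ᵗ_ g → ∃[ h ] h ⊏ᵗ g × ¬ Acc _⊏ᵗ_ h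
      next g g-¬acc with em (∃[ h ] h ⊏ᵗ g × ¬ Acc _⊏ᵗ_ h)
      ... | yes w = w
      ... | no ∄ = ⊥-elim (g-¬acc (acc λ {h} h⊏g → stable h h⊏g))
        where
        stable : ∀ h → h ⊏ᵗ g → Acc _⊏ᵗ_ h
        stable h h⊏g with em (Acc _⊏ᵗ_ h)
        ... | yes h-acc = h-acc
        ... | no h-¬acc = ⊥-elim (∄ (h , h⊏g , h-¬acc))

      chain : ℕ → Σ[ h ∈ Tuple ] ¬ Acc _⊏ᵗ_ h
      chain zero = g , g-¬acc
      chain (suc n) = let h , _ , h-¬acc = next (proj₁ (chain n)) (proj₂ (chain n)) in h , h-¬acc

      F : ℕ → Ideal
      F n = generated (proj₁ (chain n))

      chain-⊏ : ∀ n → F (suc n) ⊏ F n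
      chain-⊏ n = proj₁ (proj₂ (next (proj₁ (chain n)) (proj₂ (chain n))))

      F-step : ∀ n → F n ⊆ˢ F (suc n)
      F-step n = proj₁ (chain-⊏ n)

      F-strict : ∀ n → ¬ (F (suc n) ⊆ˢ F n)
      F-strict n = proj₂ (chain-⊏ n)

  ⊏-wellFounded : WellFounded _⊏_
  ⊏-wellFounded I = lower-acc I (⊏ᵗ-wellFounded (generators I))
    where
    generators : Ideal → Tuple
    generators I = proj₁ (noetherian I) , proj₁ (proj₂ (noetherian I))

    generates : ∀ I → I ≈ˢ generated (generators I)
    generates I = proj₂ (proj₂ (noetherian I))

    lower-acc : ∀ I → Acc _⊏ᵗ_ (generators I) → Acc _⊏_ I
    lower-acc I (acc rs) = acc λ {J} (I⊆J , J⊈I) → lower-acc J (rs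
      ( (λ x∈ → proj₁ (generates J) (I⊆J (proj₂ (generates I) x∈)))
      , (λ J⊆I → J⊈I λ x∈ → proj₂ (generates I) (J⊆I (proj₁ (generates J) x∈)))))

  +ᴵ-⊏ : (I : Ideal) → ∀ {x} → ¬ Mem I x → I +ᴵ ⟨ x ⟩ ⊏ I
  +ᴵ-⊏ I {x} x∉ = +ᴵ-inˡ I ⟨ x ⟩ , λ ⊆I → x∉ (⊆I (+ᴵ-inʳ I ⟨ x ⟩ (⟨⟩-mem x)))

  -- Maximality is tested by adjoining single elements, since `em` cannot decide statements about
  -- all ideals. If every x outside `I` makes `I +ᴵ ⟨ x ⟩` contain 1, then `I` is maximal; otherwise
  -- the recursion passes to a proper `I +ᴵ ⟨ x ⟩`.
  ∃-maximal : (I : Ideal) → ¬ Mem I 1# → ∃[ P ] IsMaximal P × I ⊆ˢ P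
  ∃-maximal I = go I (⊏-wellFounded I)
    where
    go : ∀ I → Acc _⊏_ I → ¬ Mem I 1# → ∃[ P ] IsMaximal P × I ⊆ˢ P
    go I (acc rs) 1∉ with em (∃[ x ] ¬ Mem I x × ¬ Mem (I +ᴵ ⟨ x ⟩) 1#)
    ... | yes (x , x∉ , 1∉′) with go (I +ᴵ ⟨ x ⟩) (rs (+ᴵ-⊏ I x∉)) 1∉′
    ...   | P , P-max , ⊆P = P , P-max , λ x∈ → ⊆P (+ᴵ-inˡ I ⟨ x ⟩ x∈)
    go I (acc rs) 1∉ | no ∄ = I , record
      { proper = λ (_ , ⊤⊆I) → 1∉ (⊤⊆I Unit.tt)
      ; maximal = maximal } , λ x∈ → x∈
      where
      maximal : ∀ J → I ⊆ˢ J → J ≈ˢ I ⊎ J ≈ˢ unitIdeal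
      maximal J I⊆J with em (J ⊆ˢ I)
      ... | yes J⊆I = inj₁ (J⊆I , I⊆J)
      ... | no J⊈I with ⊈⇒∃ J I J⊈I
      ...   | x , x∈J , x∉I with em (Mem (I +ᴵ ⟨ x ⟩) 1#)
      ...     | yes 1∈ = inj₂ (1∈⇒unit J (+ᴵ-least I ⟨ x ⟩ J I⊆J (⟨⟩-least J x∈J) 1∈))
      ...     | no 1∉′ = ⊥-elim (∄ (x , x∉I , 1∉′))

  ¬prime⇒∃ : (A : Ideal) → ¬ Mem A 1# → ¬ IsPrime A →
             ∃[ x ] ∃[ y ] ¬ Mem A x × ¬ Mem A y × Mem A (x * y)
  ¬prime⇒∃ A 1∉ ¬prime with em (∃[ x ] ∃[ y ] ¬ Mem A x × ¬ Mem A y × Mem A (x * y))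
  ... | yes w = w
  ... | no ∄ = ⊥-elim (¬prime record { proper = λ (_ , ⊤⊆A) → 1∉ (⊤⊆A Unit.tt) ; split = split })
    where
    split : ∀ {x y} → Mem A (x * y) → Mem A x ⊎ Mem A y
    split {x} {y} xy∈ with em (Mem A x) | em (Mem A y)
    ... | yes x∈ | _ = inj₁ x∈
    ... | no _ | yes y∈ = inj₂ y∈
    ... | no x∉ | no y∉ = ⊥-elim (∄ (x , y , x∉ , y∉ , xy∈))

  -- Invertibility of nonzero ideals.

  module _ (P : Ideal) (P-max : IsMaximal P) where

    -- Locally at P, every nonzero ideal contains a power of P.
    local-power : (A : Ideal) → IsNonzero A →
                  ∃[ s ] ∃[ n ] ¬ Mem P s × P ^ᴵ n ⊆ˢ A ∶ s
    local-power A = go A (⊏-wellFounded A)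
      where
      go : ∀ A → Acc _⊏_ A → IsNonzero A → ∃[ s ] ∃[ n ] ¬ Mem P s × P ^ᴵ n ⊆ˢ A ∶ s
      go A (acc rs) A≠0 with em (A ⊆ˢ P)
      ... | no A⊈P = let s , s∈A , s∉P = ⊈⇒∃ A P A⊈P in s , 0 , s∉P , λ {x} _ → ∈-* A x s∈A
      ... | yes A⊆P with em (P ⊆ˢ A)
      ...   | yes P⊆A = 1# , 1 , maximal-∌1 P P-max , λ x∈ →
              ∈-resp A (sym (*-identityʳ _)) (P⊆A (·-⊆ˡ P unitIdeal x∈))
      -- A nonzero ideal strictly inside P is not prime, because nonzero primes are maximal. So x y
      -- lies in `A` for some x and y outside it, and the product of `A +ᴵ ⟨ x ⟩` and `A +ᴵ ⟨ y ⟩`,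
      -- both strictly larger, falls back into `A`.
      ...   | no P⊈A = combine (¬prime⇒∃ A (λ 1∈ → maximal-∌1 P P-max (A⊆P 1∈)) ¬prime)
        where
        ¬prime : ¬ IsPrime A
        ¬prime A-prime with IsMaximal.maximal (nonzeroPrimeMaximal A A≠0 A-prime) P A⊆P
        ... | inj₁ (P⊆A , _) = P⊈A P⊆A
        ... | inj₂ P≈⊤ = IsMaximal.proper P-max P≈⊤

        combine : ∃[ x ] ∃[ y ] ¬ Mem A x × ¬ Mem A y × Mem A (x * y) →
                  ∃[ s ] ∃[ n ] ¬ Mem P s × P ^ᴵ n ⊆ˢ A ∶ s
        combine (x , y , x∉ , y∉ , xy∈)
          with go (A +ᴵ ⟨ x ⟩) (rs (+ᴵ-⊏ A x∉)) (nonzero-mono A (A +ᴵ ⟨ x ⟩) (+ᴵ-inˡ A ⟨ x ⟩) A≠0)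
             | go (A +ᴵ ⟨ y ⟩) (rs (+ᴵ-⊏ A y∉)) (nonzero-mono A (A +ᴵ ⟨ y ⟩) (+ᴵ-inˡ A ⟨ y ⟩) A≠0)
        ... | s , m , s∉ , s⊆ | t , n , t∉ , t⊆ =
          s * t , m ℕ.+ n , maximal-*∉ P P-max s∉ t∉ , λ z∈ →
          ·-least (P ^ᴵ m) (P ^ᴵ n) (A ∶ (s * t)) (λ u∈ v∈ → product (s⊆ u∈) (t⊆ v∈))
            (proj₁ (^ᴵ-+ P m n) z∈)
          where
          product : ∀ {u v} → Mem (A +ᴵ ⟨ x ⟩) (u * s) → Mem (A +ᴵ ⟨ y ⟩) (v * t) →
                    Mem A ((u * v) * (s * t))
          product {u} {v} (a , x′ , a∈ , (q , x′≈) , e) (b , y′ , b∈ , (r , y′≈) , e′) =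
            ∈-resp A
              (trans (solve 6 (λ a b q r x y →
                  (b :+ r :* y) :* a :+ (q :* x :* b :+ q :* r :* (x :* y))
                  := (a :+ q :* x) :* (b :+ r :* y)) refl a b q r x y)
                (trans (*-cong (trans (+-congˡ (sym x′≈)) (sym e)) (trans (+-congˡ (sym y′≈)) (sym e′)))
                  (solve 4 (λ u v s t → (u :* s) :* (v :* t) := (u :* v) :* (s :* t)) refl u v s t)))
              (∈-+ A (∈-* A _ a∈) (∈-+ A (∈-* A _ b∈) (∈-* A _ xy∈)))

    -- b/a lies in P⁻¹ but not in 𝒪.
    inverse-element : ∀ {a} → a ≉ 0# → Mem P a →
                      ∃[ b ] ¬ Mem ⟨ a ⟩ b × (∀ {p} → Mem P p → Mem ⟨ a ⟩ (b * p))
    inverse-element {a} a≉0 a∈P with local-power ⟨ a ⟩ (∋⇒nonzero ⟨ a ⟩ (⟨⟩-mem a) a≉0)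
    ... | s , n , s∉P , P^n⊆ = descend n P^n⊆
      where
      descend : ∀ n → P ^ᴵ n ⊆ˢ ⟨ a ⟩ ∶ s →
                ∃[ b ] ¬ Mem ⟨ a ⟩ b × (∀ {p} → Mem P p → Mem ⟨ a ⟩ (b * p))
      descend zero ⊤⊆ = ⊥-elim (s∉P (⟨⟩-least P a∈P
        (∈-resp ⟨ a ⟩ (*-identityˡ s) (⊤⊆ {1#} Unit.tt))))
      descend (suc n) P^1+n⊆ with em (P ^ᴵ n ⊆ˢ ⟨ a ⟩ ∶ s)
      ... | yes P^n⊆ = descend n P^n⊆
      ... | no P^n⊈ with ⊈⇒∃ (P ^ᴵ n) (⟨ a ⟩ ∶ s) P^n⊈
      -- At an exponent where the inclusion fails for n but holds for n + 1, an x witnessing the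
      -- failure gives b = x s: it is outside ⟨ a ⟩, and one more factor from P brings it in.
      ...   | x , x∈ , xs∉ = x * s , xs∉ , λ {p} p∈ → ∈-resp ⟨ a ⟩
              (solve 3 (λ p x s → (p :* x) :* s := (x :* s) :* p) refl p x s)
              (P^1+n⊆ (·-mem P (P ^ᴵ n) p∈ x∈))

  -- Built from principal ideals rather than as a span, so that a member carries exactly one
  -- coefficient for each of f 0, ..., f (n - 1), as an integral equation demands.
  combinations : ℕ → (ℕ → Carrier) → Ideal
  combinations zero f = ⟨ 0# ⟩
  combinations (suc n) f = ⟨ f 0 ⟩ +ᴵ combinations n (f ∘ suc)

  combinations-step : ∀ n f → combinations n f ⊆ˢ combinations (suc n) f
  combinations-step zero f = ⟨⟩-least (⟨ f 0 ⟩ +ᴵ ⟨ 0# ⟩) (0∈ (⟨ f 0 ⟩ +ᴵ ⟨ 0# ⟩))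
  combinations-step (suc n) f (u , v , u∈ , v∈ , e) =
    u , v , u∈ , combinations-step n (f ∘ suc) v∈ , e

  combinations-last : ∀ n f → Mem (combinations (suc n) f) (f n)
  combinations-last zero f = +ᴵ-inˡ ⟨ f 0 ⟩ ⟨ 0# ⟩ (⟨⟩-mem (f 0))
  combinations-last (suc n) f =
    +ᴵ-inʳ ⟨ f 0 ⟩ (combinations (suc n) (f ∘ suc)) (combinations-last n (f ∘ suc))

  combinations-sum : ∀ n f {x} → Mem (combinations n f) x →
                     Σ[ s ∈ Vector Carrier n ] x ≈ sum (λ i → s i * f (toℕ i))
  combinations-sum zero f (q , e) = (λ ()) , trans e (zeroʳ q)
  combinations-sum (suc n) f (u , v , (q , u≈) , v∈ , e) with combinations-sum n (f ∘ suc) v∈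
  ... | s , v≈ = q Vector.∷ s , trans e (+-cong u≈ v≈)

  -- The elements d n = a (b/a)ⁿ all lie in I; as 𝒪 is noetherian, some d n is a
  -- combination of the earlier ones, which is an integral equation for b/a.
  integral : (I : Ideal) → ∀ {a b} → a ≉ 0# → Mem I a →
             (∀ {j} → Mem I j → ∃[ z ] Mem I z × b * j ≈ a * z) → Mem ⟨ a ⟩ b
  integral I {a} {b} a≉0 a∈ stable =
    -- The fraction called a / b in `IsIntegrallyClosed` is b / a here.
    let q , qa≈b = integrallyClosed b a a≉0 n (λ i → - s i) equation in q , sym qa≈b
    where
    open SetoidReasoning setoid

    orbit : ℕ → Σ[ x ∈ Carrier ] Mem I x
    orbit zero = a , a∈
    orbit (suc n) = let z , z∈ , _ = stable (proj₂ (orbit n)) in z , z∈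

    d : ℕ → Carrier
    d n = proj₁ (orbit n)

    d-step : ∀ n → b * d n ≈ a * d (suc n)
    d-step n = proj₂ (proj₂ (stable (proj₂ (orbit n))))

    d-power : ∀ n → b ^ n * a ≈ a ^ n * d n
    d-power zero = refl
    d-power (suc n) = begin
      b * b ^ n * a           ≈⟨ *-assoc b _ a ⟩
      b * (b ^ n * a)         ≈⟨ *-congˡ (d-power n) ⟩
      b * (a ^ n * d n)       ≈⟨ solve 3 (λ b x y → b :* (x :* y) := x :* (b :* y)) refl b (a ^ n) (d n) ⟩
      a ^ n * (b * d n)       ≈⟨ *-congˡ (d-step n) ⟩
      a ^ n * (a * d (suc n)) ≈⟨ solve 3 (λ x a y → x :* (a :* y) := (a :* x) :* y) refl (a ^ n) a _ ⟩
      a * a ^ n * d (suc n)   ∎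

    stable-at : ∃[ n ] combinations (suc n) d ⊆ˢ combinations n d
    stable-at = AscendingChain.stabilises (λ n → combinations n d) (λ n → combinations-step n d)

    n : ℕ
    n = proj₁ stable-at

    d∈ : Σ[ s ∈ Vector Carrier n ] d n ≈ sum (λ i → s i * d (toℕ i))
    d∈ = combinations-sum n d (proj₂ stable-at (combinations-last n d))

    s : Vector Carrier n
    s = proj₁ d∈

    T : Fin n → Carrier
    T i = b ^ toℕ i * a ^ (n ∸ toℕ i)

    term : ∀ i → a ^ n * (s i * d (toℕ i)) ≈ a * (s i * T i)
    term i = begin
      a ^ n * (s i * d k)
        ≈⟨ *-congʳ (trans (^-congʳ a (≡.sym (ℕ.m∸n+n≡m (ℕ.<⇒≤ (toℕ<n i))))) (^-homo-* a (n ∸ k) k)) ⟩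
      (a ^ (n ∸ k) * a ^ k) * (s i * d k)
        ≈⟨ solve 4 (λ x y s d → (x :* y) :* (s :* d) := (s :* x) :* (y :* d)) refl (a ^ (n ∸ k)) (a ^ k) (s i) (d k) ⟩
      (s i * a ^ (n ∸ k)) * (a ^ k * d k)
        ≈⟨ *-congˡ (d-power k) ⟨
      (s i * a ^ (n ∸ k)) * (b ^ k * a)
        ≈⟨ solve 4 (λ s x y a → (s :* x) :* (y :* a) := a :* (s :* (y :* x))) refl (s i) (a ^ (n ∸ k)) (b ^ k) a ⟩
      a * (s i * T i) ∎
      where
      k = toℕ i

    -- Multiplying the relation for `d n` by aⁿ turns each `d` into powers of a and b. The extra
    -- factor a on both sides comes from `d 0` being a, and it cancels.
    b^n≈ : b ^ n ≈ sum (λ i → s i * T i)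
    b^n≈ = *-cancelˡ a≉0 (begin
      a * b ^ n                                 ≈⟨ *-comm a _ ⟩
      b ^ n * a                                 ≈⟨ d-power n ⟩
      a ^ n * d n                               ≈⟨ *-congˡ (proj₂ d∈) ⟩
      a ^ n * sum (λ i → s i * d (toℕ i))       ≈⟨ *-distribˡ-sum (a ^ n) (λ i → s i * d (toℕ i)) ⟩
      sum (λ i → a ^ n * (s i * d (toℕ i)))     ≈⟨ sum-cong-≋ term ⟩
      sum (λ i → a * (s i * T i))               ≈⟨ *-distribˡ-sum a (λ i → s i * T i) ⟨
      a * sum (λ i → s i * T i)                 ∎)

    equation : b ^ n + sum (λ i → - s i * T i) ≈ 0#
    equation = begin
      b ^ n + sum (λ i → - s i * T i)
        ≈⟨ +-congˡ (sum-cong-≋ λ i → solve 2 (λ s t → :- s :* t := (:- con ℤ.1ℤ) :* (s :* t)) refl (s i) (T i)) ⟩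
      b ^ n + sum (λ i → - 1# * (s i * T i))
        ≈⟨ +-cong b^n≈ (sym (*-distribˡ-sum (- 1#) (λ i → s i * T i))) ⟩
      Σs + - 1# * Σs
        ≈⟨ solve 1 (λ x → x :+ (:- con ℤ.1ℤ) :* x := con ℤ.0ℤ) refl Σs ⟩
      0# ∎
      where
      Σs = sum (λ i → s i * T i)

  infixr 7 _⋆_

  -- As an ideal this is `⟨ e ⟩ · I`, but each member is displayed as one multiple of e instead of a
  -- sum of products, so that e can be cancelled.
  _⋆_ : Carrier → Ideal → Ideal
  e ⋆ I = record
    { Mem = λ x → ∃[ w ] Mem I w × x ≈ e * w
    ; resp = λ x≈y (w , w∈ , x≈) → w , w∈ , trans (sym x≈y) x≈
    ; 0-mem = 0# , 0∈ I , sym (zeroʳ e)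
    ; +-mem = λ (v , v∈ , x≈) (w , w∈ , y≈) →
        v + w , ∈-+ I v∈ w∈ , trans (+-cong x≈ y≈) (sym (distribˡ e v w))
    ; *-mem = λ r (w , w∈ , x≈) → r * w , ∈-* I r w∈ ,
        trans (*-congˡ x≈) (solve 3 (λ r e w → r :* (e :* w) := e :* (r :* w)) refl r e w) }

  ⋆-cancel : ∀ {e} → e ≉ 0# → (I : Ideal) → ∀ {x} → Mem (e ⋆ I) (e * x) → Mem I x
  ⋆-cancel e≉0 I (w , w∈ , ex≈ew) = ∈-resp I (sym (*-cancelˡ e≉0 ex≈ew)) w∈

  ⟨⟩·-⊆⋆ : ∀ e (I : Ideal) → ⟨ e ⟩ · I ⊆ˢ e ⋆ I
  ⟨⟩·-⊆⋆ e I = ·-least ⟨ e ⟩ I (e ⋆ I) λ {u} {v} (q , u≈qe) v∈ → q * v , ∈-* I q v∈ ,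
    trans (*-congʳ u≈qe) (solve 3 (λ q e v → (q :* e) :* v := e :* (q :* v)) refl q e v)

  -- The inverse fractional ideal is J / e, with its denominator kept apart.
  Invertible : Ideal → Set (lsuc (c ⊔ ℓ))
  Invertible I = ∃[ J ] ∃[ e ] e ≉ 0# × I · J ≈ˢ ⟨ e ⟩

  -- An element b / a of P⁻¹ outside 𝒪 enlarges I to I + (b / a) I, which is still an ideal of 𝒪
  -- because I lies in P. An inverse of the larger ideal yields one of I.
  invertible : (I : Ideal) → IsNonzero I → Invertible I
  invertible I = go I (⊏-wellFounded I)
    where
    go : ∀ I → Acc _⊏_ I → IsNonzero I → Invertible I
    go I (acc rs) I≠0 with em (Mem I 1#)
    ... | yes 1∈ = unitIdeal , 1# , 1≉0 ,
      (λ {x} _ → x , sym (*-identityʳ x)) ,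
      λ (q , x≈) → resp (sym x≈) (mul q (resp (*-identityʳ 1#) (·-mem I unitIdeal 1∈ Unit.tt)))
    ... | no 1∉ with ∃-maximal I 1∉ | nonzero-element I I≠0
    ...   | P , P-max , I⊆P | a , a∈I , a≉0 with inverse-element P P-max a≉0 (I⊆P a∈I)
    ...     | b , b∉ , bP⊆ = enlarge (go I′ (rs (I⊆I′ , I′⊈I)) (nonzero-mono I I′ I⊆I′ I≠0))
      where
      -- I′ = I + (b/a) I is strictly larger than I, since b/a is not integral.
      S I′ : Ideal
      S = ⟨ a ⟩ +ᴵ ⟨ b ⟩
      I′ = (S · I) ∶ a

      I⊆I′ : I ⊆ˢ I′
      I⊆I′ {x} x∈ = resp (*-comm a x) (·-mem S I (+ᴵ-inˡ ⟨ a ⟩ ⟨ b ⟩ (⟨⟩-mem a)) x∈)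

      I′⊈I : ¬ (I′ ⊆ˢ I)
      I′⊈I I′⊆I = b∉ (integral I a≉0 a∈I λ {j} j∈ →
        let z , bj≈za = bP⊆ (I⊆P j∈) in
        z , I′⊆I (resp bj≈za (·-mem S I (+ᴵ-inʳ ⟨ a ⟩ ⟨ b ⟩ (⟨⟩-mem b)) j∈)) ,
        trans bj≈za (*-comm z a))

      S·I⊆⟨a⟩ : S · I ⊆ˢ ⟨ a ⟩
      S·I⊆⟨a⟩ = ·-least S I ⟨ a ⟩ λ {_} {v} s∈ v∈ →
        +ᴵ-least ⟨ a ⟩ ⟨ b ⟩ (⟨ a ⟩ ∶ v)
          (⟨⟩-least (⟨ a ⟩ ∶ v) (∈-*ʳ ⟨ a ⟩ v (⟨⟩-mem a)))
          (⟨⟩-least (⟨ a ⟩ ∶ v) (bP⊆ (I⊆P v∈))) s∈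

      -- Since `S · I` lies in ⟨ a ⟩, it equals a times `I′`; multiplying I′ J = ⟨ e ⟩ by a thus
      -- gives I (S J) = ⟨ e a ⟩.
      enlarge : Invertible I′ → Invertible I
      enlarge (J , e , e≉0 , I′J⊆ , ⊆I′J) = S · J , e * a , *-≉0 e≉0 a≉0 ,
        (λ x∈ → S·I·J⊆ (proj₁ reorder x∈)) ,
        λ (q , x≈) → resp (sym x≈) (mul q (proj₂ reorder
          (·-least I′ J (((S · I) · J) ∶ a)
            (λ z∈ v∈ → resp
              (solve 3 (λ z a v → (z :* a) :* v := (z :* v) :* a) refl _ a _)
              (·-mem (S · I) J z∈ v∈))
            (⊆I′J (⟨⟩-mem e)))))
        where
        reorder : I · (S · J) ≈ˢ (S · I) · J
        reorder = ≐-trans (·-swapˡ I S J) (≐-sym (·-assoc S I J))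

        S·I·J⊆ : (S · I) · J ⊆ˢ ⟨ e * a ⟩
        S·I·J⊆ = ·-least (S · I) J ⟨ e * a ⟩ λ {u} {v} u∈ v∈ →
          let z , u≈za = S·I⊆⟨a⟩ u∈
              q , zv≈qe = I′J⊆ (·-mem I′ J (resp u≈za u∈) v∈)
          in q , trans (*-congʳ u≈za) (trans
            (solve 3 (λ z a v → (z :* a) :* v := (z :* v) :* a) refl z a v)
            (trans (*-congʳ zv≈qe) (*-assoc q e a)))

  -- Multiplication by a J with L J = ⟨ e ⟩ puts e z into e I, and e cancels.
  ·-cancelˡ : (L I : Ideal) → IsNonzero L → ∀ {z} →
              (∀ {t} → Mem L t → Mem (L · I) (t * z)) → Mem I z
  ·-cancelˡ L I L≠0 {z} Lz⊆LI with invertible L L≠0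
  ... | J , e , e≉0 , LJ⊆ , ⊆LJ = ⋆-cancel e≉0 I (⟨⟩·-⊆⋆ e I
    (·-mono (L · J) ⟨ e ⟩ I I LJ⊆ (λ y → y)
      (proj₂ reorder (·-least L J ((J · (L · I)) ∶ z)
        (λ {t} {j} t∈ j∈ → resp (solve 3 (λ t j z → j :* (t :* z) := (t :* j) :* z) refl t j z)
          (·-mem J (L · I) j∈ (Lz⊆LI t∈)))
        (⊆LJ (⟨⟩-mem e))))))
    where
    reorder : (L · J) · I ≈ˢ J · (L · I)
    reorder = ≐-trans (·-assoc L J I) (·-swapˡ L J I)

  -- Induction along a prime factorisation.

  module FactorInduction {q} (Q : Ideal → Set q)
    (Q-resp : ∀ I J → I ≈ˢ J → Q I → Q J)
    (Q-unit : Q unitIdeal)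
    (Q-· : ∀ P J → IsMaximal P → Q J → Q (P · J)) where

    -- For a maximal P containing I, the quotient J = I P⁻¹ satisfies P J = I. It is strictly larger
    -- than I: if J were inside I, then I would lie in P I, and cancelling I would put 1 into P.
    factor-induction : (I : Ideal) → IsNonzero I → Q I
    factor-induction I = go I (⊏-wellFounded I)
      where
      go : ∀ I → Acc _⊏_ I → IsNonzero I → Q I
      go I (acc rs) I≠0 with em (Mem I 1#)
      ... | yes 1∈ = Q-resp unitIdeal I (≐-sym (1∈⇒unit I 1∈)) Q-unit
      ... | no 1∉ with ∃-maximal I 1∉
      ...   | P , P-max , I⊆P with invertible P (nonzero-mono I P I⊆P I≠0)
      ...     | P′ , e , e≉0 , PP′⊆ , ⊆PP′ =
        Q-resp (P · J) I (P·J⊆I , I⊆P·J)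
          (Q-· P J P-max (go J (rs (I⊆J , J⊈I)) (nonzero-mono I J I⊆J I≠0)))
        where
        J : Ideal
        J = (P′ · I) ∶ e

        I⊆J : I ⊆ˢ J
        I⊆J {x} x∈ = resp (*-comm e x) (·-mem P′ I (·-⊆ʳ P P′ (⊆PP′ (⟨⟩-mem e))) x∈)

        P·J⊆I : P · J ⊆ˢ I
        P·J⊆I = ·-least P J I λ {p} {z} p∈ z∈ → ⋆-cancel e≉0 I (⟨⟩·-⊆⋆ e I
          (·-mono (P · P′) ⟨ e ⟩ I I PP′⊆ (λ y → y) (·-assoc-⊇ P P′ I
            (resp (solve 3 (λ p z e → p :* (z :* e) := e :* (p :* z)) refl p z e)
              (·-mem P (P′ · I) p∈ z∈)))))

        I⊆P·J : I ⊆ˢ P · J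
        I⊆P·J {x} x∈ = ⋆-cancel e≉0 (P · J) (·-least P P′ ((e ⋆ (P · J)) ∶ x)
          (λ {p} {p′} p∈ p′∈ →
            let z , xp′≈ze = PP′⊆ (·-mem P P′ (I⊆P x∈) p′∈) in
            p * z , ·-mem P J p∈ (resp (trans (*-comm p′ x) xp′≈ze) (·-mem P′ I p′∈ x∈)) ,
            trans (solve 3 (λ p p′ x → (p :* p′) :* x := p :* (x :* p′)) refl p p′ x)
              (trans (*-congˡ xp′≈ze)
                (solve 3 (λ p z e → p :* (z :* e) := e :* (p :* z)) refl p z e)))
          (⊆PP′ (⟨⟩-mem e)))

        J⊈I : ¬ (J ⊆ˢ I)
        J⊈I J⊆I = maximal-∌1 P P-max (·-cancelˡ I P I≠0 λ {t} t∈ →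
          resp (sym (*-identityʳ t)) (·-comm-⊆ P I
            (·-mono P P J I (λ y → y) J⊆I (I⊆P·J t∈))))

  -- Lifting unimodular pairs from 𝒪 modulo `K` to 𝒪.

  module _ (K : Ideal) where

    private
      -- A stable-range condition, phrased as a predicate of `A` alone so that factor induction
      -- applies to it.
      Lifts : Ideal → Set (c ⊔ ℓ)
      Lifts A = ∀ t → Comaximal A (⟨ t ⟩ +ᴵ K) → ∃[ κ ] Mem K κ × Comaximal A ⟨ t + κ ⟩

      lifts-resp : ∀ A B → A ≈ˢ B → Lifts A → Lifts B
      lifts-resp A B (A⊆B , B⊆A) lifts t co =
        let T = ⟨ t ⟩ +ᴵ K
            κ , κ∈ , co′ = lifts t (comaximal-mono B A T T B⊆A (λ x → x) co)
        in κ , κ∈ , comaximal-mono A B ⟨ t + κ ⟩ ⟨ t + κ ⟩ A⊆B (λ x → x) co′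

      lifts-unit : Lifts unitIdeal
      lifts-unit t _ = 0# , 0∈ K , +ᴵ-inˡ unitIdeal ⟨ t + 0# ⟩ Unit.tt

      -- If t + κ₁ is prime to J but lies in P, then adding x y with x in J and
      -- y in K, both outside P, makes it prime to P as well.
      lifts-· : ∀ P J → IsMaximal P → Lifts J → Lifts (P · J)
      lifts-· P J P-max lifts t co
        with lifts t (comaximal-mono (P · J) J T T (·-⊆ʳ P J) (λ x → x) co)
        where T = ⟨ t ⟩ +ᴵ K
      ... | κ₁ , κ₁∈ , co₁ = choose (em (Mem P (t + κ₁)))
        where
        both : ∀ {t} → ¬ Mem P t → Comaximal J ⟨ t ⟩ → Comaximal (P · J) ⟨ t ⟩
        both {t} t∉ co = comaximal-sym ⟨ t ⟩ (P · J) (comaximal-· ⟨ t ⟩ P J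
          (comaximal-sym P ⟨ t ⟩ (maximal-comaximal P P-max t∉)) (comaximal-sym J ⟨ t ⟩ co))

        shift : ∀ {x} y → Mem J x → Comaximal J ⟨ t + κ₁ ⟩ → Comaximal J ⟨ t + (κ₁ + x * y) ⟩
        shift {x} y x∈ (j , w , j∈ , (q , w≈) , e) =
          j - q * (x * y) , q * (t + (κ₁ + x * y)) ,
          ∈-+ J j∈ (-‿mem J (∈-* J q (∈-*ʳ J y x∈))) , (q , refl) ,
          trans e (trans (+-congˡ w≈) (solve 6 (λ j q t k x y →
            j :+ q :* (t :+ k) := (j :- q :* (x :* y)) :+ q :* (t :+ (k :+ x :* y)))
            refl j q t κ₁ x y))

        choose : Dec (Mem P (t + κ₁)) → ∃[ κ ] Mem K κ × Comaximal (P · J) ⟨ t + κ ⟩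
        choose (no t₁∉) = κ₁ , κ₁∈ , both t₁∉ co₁
        choose (yes t₁∈) =
          -- P does not contain `J`, since `t + κ₁` lies in P and is prime to `J`. It does not
          -- contain `K` either: then `t` would lie in P as well, and `co` would put 1 into P.
          let x , x∈J , x∉P = ⊈⇒∃ J P J⊈P
              y , y∈K , y∉P = ⊈⇒∃ K P K⊈P
          in κ₁ + x * y , ∈-+ K κ₁∈ (∈-* K x y∈K) ,
             both (λ t₂∈ → maximal-*∉ P P-max x∉P y∉P (∈-resp P
                 (solve 3 (λ t k z → (t :+ (k :+ z)) :- (t :+ k) := z) refl t κ₁ (x * y))
                 (∈-+ P t₂∈ (-‿mem P t₁∈))))
               (shift y x∈J co₁)
          where
          J⊈P : ¬ (J ⊆ˢ P)
          J⊈P J⊆P = maximal-∌1 P P-max (+ᴵ-least J ⟨ t + κ₁ ⟩ P J⊆P (⟨⟩-least P t₁∈) co₁)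

          K⊈P : ¬ (K ⊆ˢ P)
          K⊈P K⊆P = maximal-∌1 P P-max (+ᴵ-least (P · J) (⟨ t ⟩ +ᴵ K) P (·-⊆ˡ P J)
            (+ᴵ-least ⟨ t ⟩ K P
              (⟨⟩-least P (∈-resp P (solve 2 (λ t k → (t :+ k) :- k := t) refl t κ₁)
                (∈-+ P t₁∈ (-‿mem P (K⊆P κ₁∈)))))
              K⊆P) co)

    comaximal-lift : (A : Ideal) → IsNonzero A → Lifts A
    comaximal-lift = FactorInduction.factor-induction Lifts lifts-resp lifts-unit lifts-·

    -- The first entry is fixed and the second is moved modulo K until it is prime to the first.
    -- This uses factor induction on ⟨ a ⟩, so a must be nonzero: a vanishing t₁ is replaced by a
    -- nonzero element of K.
    unimodular-lift : IsNonzero K → ∀ u v t₁ t₂ → Mem K (1# - (u * t₁ + v * t₂)) →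
                      ∃[ a ] ∃[ b ] Comaximal ⟨ a ⟩ ⟨ b ⟩ × Mem K (a - t₁) × Mem K (b - t₂)
    unimodular-lift K≠0 u v t₁ t₂ 1-∈ with nonzero-representative
      where
      nonzero-representative : ∃[ a ] a ≉ 0# × Mem K (a - t₁)
      nonzero-representative with t₁ ≟0
      ... | no t₁≉0 = t₁ , t₁≉0 , ∈-resp K (sym (-‿inverseʳ t₁)) (0∈ K)
      ... | yes t₁≈0 = let κ , κ∈ , κ≉0 = nonzero-element K K≠0 in
        κ , κ≉0 , ∈-resp K
          (trans (solve 1 (λ k → k := k :- con ℤ.0ℤ) refl κ) (+-congˡ (-‿cong (sym t₁≈0)))) κ∈
    ... | a , a≉0 , a-t₁∈ =
      let κ , κ∈ , co = comaximal-lift ⟨ a ⟩ (∋⇒nonzero ⟨ a ⟩ (⟨⟩-mem a) a≉0) t₂ comaximal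
      in a , t₂ + κ , co , a-t₁∈ , ∈-resp K (solve 2 (λ t k → k := (t :+ k) :- t) refl t₂ κ) κ∈
      where
      rest : Carrier
      rest = (1# - (u * t₁ + v * t₂)) - u * (a - t₁)

      comaximal : Comaximal ⟨ a ⟩ (⟨ t₂ ⟩ +ᴵ K)
      comaximal = u * a , v * t₂ + rest , (u , refl) ,
        (v * t₂ , rest , (v , refl) , ∈-+ K 1-∈ (-‿mem K (∈-* K u a-t₁∈)) , refl) ,
        solve 5 (λ u v a t s → con ℤ.1ℤ := u :* a :+
            (v :* s :+ ((con ℤ.1ℤ :- (u :* t :+ v :* s)) :- u :* (a :- t))))
          refl u v a t₁ t₂

  -- Simultaneous factorisation of `L` and `K`.

  record Factors (L K : Ideal) : Set (lsuc (c ⊔ ℓ)) where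
    field
      r          : ℕ
      𝔪          : Vector Ideal r
      𝔪-maximal  : ∀ i → IsMaximal (𝔪 i)
      𝔪-distinct : ∀ {i j} → i ≢ j → ¬ (𝔪 i ≈ˢ 𝔪 j)
      l k        : Vector ℕ r
      l≤k        : ∀ i → l i ℕ.≤ k i
      k≢0        : ∀ i → k i ≢ 0
      L-factors  : L ≈ˢ ∏ (λ i → 𝔪 i ^ᴵ l i)
      K-factors  : K ≈ˢ ∏ (λ i → 𝔪 i ^ᴵ k i)

  factors-resp : ∀ {L L′ K K′} → L′ ≈ˢ L → K′ ≈ˢ K → Factors L K → Factors L′ K′
  factors-resp L≈ K≈ F = record
    { Factors F
    ; L-factors = ≐-trans L≈ (Factors.L-factors F)
    ; K-factors = ≐-trans K≈ (Factors.K-factors F) }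

  single : ∀ {r} → ℕ → Fin r → Vector ℕ r
  single x zero zero = x
  single x zero (suc j) = 0
  single x (suc i) zero = 0
  single x (suc i) (suc j) = single x i j

  single-mono : ∀ {r x y} → x ℕ.≤ y → (i j : Fin r) → single x i j ℕ.≤ single y i j
  single-mono x≤y zero zero = x≤y
  single-mono x≤y zero (suc j) = ℕ.z≤n
  single-mono x≤y (suc i) zero = ℕ.z≤n
  single-mono x≤y (suc i) (suc j) = single-mono x≤y i j

  ∏-single : ∀ {r} (𝔪 : Vector Ideal r) (e : Vector ℕ r) x i →
             ∏ (λ j → 𝔪 j ^ᴵ (single x i j ℕ.+ e j)) ≈ˢ 𝔪 i ^ᴵ x · ∏ (λ j → 𝔪 j ^ᴵ e j)
  ∏-single 𝔪 e x zero = ≐-trans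
    (·-congʳ {R} {𝔪 zero ^ᴵ (x ℕ.+ e zero)} {𝔪 zero ^ᴵ x · 𝔪 zero ^ᴵ e zero}
      (^ᴵ-+ (𝔪 zero) x (e zero)))
    (·-assoc (𝔪 zero ^ᴵ x) (𝔪 zero ^ᴵ e zero) R)
    where R = ∏ (λ j → 𝔪 (suc j) ^ᴵ e (suc j))
  ∏-single 𝔪 e x (suc i) = ≐-trans
    (·-congˡ {𝔪 zero ^ᴵ e zero} {∏ (λ j → 𝔪 (suc j) ^ᴵ (single x i j ℕ.+ e (suc j)))}
      {𝔪 (suc i) ^ᴵ x · R} (∏-single (𝔪 ∘ suc) (e ∘ suc) x i))
    (·-swapˡ (𝔪 zero ^ᴵ e zero) (𝔪 (suc i) ^ᴵ x) R)
    where R = ∏ (λ j → 𝔪 (suc j) ^ᴵ e (suc j))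

  ^ᴵ-cong : ∀ {I J} → I ≈ˢ J → ∀ n → I ^ᴵ n ≈ˢ J ^ᴵ n
  ^ᴵ-cong I≈J zero = ≐-refl
  ^ᴵ-cong {I} {J} I≈J (suc n) = ·-cong {I} {J} {I ^ᴵ n} {J ^ᴵ n} I≈J (^ᴵ-cong I≈J n)

  -- x = 1 multiplies both ideals by P, x = 0 only the second.
  multiply-factors : ∀ {L K} x → x ℕ.≤ 1 → (P : Ideal) → IsMaximal P →
                     Factors L K → Factors (P ^ᴵ x · L) (P ^ᴵ 1 · K)
  multiply-factors {L} {K} x x≤1 P P-max F = dispatch (em (∃[ i ] P ≈ˢ 𝔪 i))
    where
    open Factors F

    dispatch : Dec (∃[ i ] P ≈ˢ 𝔪 i) → Factors (P ^ᴵ x · L) (P ^ᴵ 1 · K)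
    dispatch (yes (i , P≈)) = record
      { r = r ; 𝔪 = 𝔪 ; 𝔪-maximal = 𝔪-maximal ; 𝔪-distinct = 𝔪-distinct
      ; l = λ j → single x i j ℕ.+ l j
      ; k = λ j → single 1 i j ℕ.+ k j
      ; l≤k = λ j → ℕ.+-mono-≤ (single-mono x≤1 i j) (l≤k j)
      ; k≢0 = λ j k≡0 → k≢0 j (ℕ.m+n≡0⇒n≡0 (single 1 i j) k≡0)
      ; L-factors = factors {L} x l L-factors
      ; K-factors = factors {K} 1 k K-factors }
      where
      factors : ∀ {J} x e → J ≈ˢ ∏ (λ j → 𝔪 j ^ᴵ e j) →
                P ^ᴵ x · J ≈ˢ ∏ (λ j → 𝔪 j ^ᴵ (single x i j ℕ.+ e j))
      factors {J} x e J≈ = ≐-trans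
        (·-cong {P ^ᴵ x} {𝔪 i ^ᴵ x} {J} {∏ (λ j → 𝔪 j ^ᴵ e j)} (^ᴵ-cong P≈ x) J≈)
        (≐-sym (∏-single 𝔪 e x i))
    -- A new prime has exponent 1 in the second ideal, which secures `k≢0`, even if its exponent in
    -- the first is 0.
    dispatch (no P≉) = record
      { r = suc r ; 𝔪 = P Vector.∷ 𝔪
      ; 𝔪-maximal = λ { zero → P-max ; (suc i) → 𝔪-maximal i }
      ; 𝔪-distinct = λ {i} {j} → distinct i j
      ; l = x Vector.∷ l ; k = 1 Vector.∷ k
      ; l≤k = λ { zero → x≤1 ; (suc i) → l≤k i }
      ; k≢0 = λ { zero () ; (suc i) → k≢0 i }
      ; L-factors = ·-congˡ {P ^ᴵ x} {L} {∏ (λ i → 𝔪 i ^ᴵ l i)} L-factors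
      ; K-factors = ·-congˡ {P ^ᴵ 1} {K} {∏ (λ i → 𝔪 i ^ᴵ k i)} K-factors }
      where
      distinct : ∀ i j → i ≢ j → ¬ ((P Vector.∷ 𝔪) i ≈ˢ (P Vector.∷ 𝔪) j)
      distinct zero zero 0≢0 = ⊥-elim (0≢0 ≡.refl)
      distinct zero (suc j) _ P≈ = P≉ (j , P≈)
      distinct (suc i) zero _ ≈P = P≉ (i , ≐-sym ≈P)
      distinct (suc i) (suc j) i≢j = 𝔪-distinct (i≢j ∘ ≡.cong suc)

  P·≈P^1· : (P J : Ideal) → P · J ≈ˢ P ^ᴵ 1 · J
  P·≈P^1· P J = ·-congʳ {J} {P} {P ^ᴵ 1} (≐-sym (·-identityʳ P))

  -- Starting from the unit ideals, the primes of `L` are multiplied into both ideals, then those of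
  -- `I` into the second only. The exponents satisfy l ≤ k by construction, without comparing two
  -- independent factorisations. No submodule is involved, so one factorisation serves all lattices.
  factorise : (L I : Ideal) → IsNonzero L → IsNonzero I → Factors L (L · I)
  factorise L I L≠0 I≠0 = multiples I I≠0
    where
    diagonal : (L : Ideal) → IsNonzero L → Factors L L
    diagonal = FactorInduction.factor-induction (λ L → Factors L L)
      (λ L L′ L≈L′ → factors-resp (≐-sym L≈L′) (≐-sym L≈L′))
      record { r = 0 ; 𝔪 = λ () ; 𝔪-maximal = λ () ; 𝔪-distinct = λ { {()} }
             ; l = λ () ; k = λ () ; l≤k = λ () ; k≢0 = λ ()
             ; L-factors = ≐-refl ; K-factors = ≐-refl }
      (λ P J P-max F → factors-resp (P·≈P^1· P J) (P·≈P^1· P J)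
        (multiply-factors 1 ℕ.≤-refl P P-max F))

    multiples : (I : Ideal) → IsNonzero I → Factors L (L · I)
    multiples = FactorInduction.factor-induction (λ I → Factors L (L · I))
      (λ I J I≈J → factors-resp ≐-refl (·-congˡ {L} {J} {I} (≐-sym I≈J)))
      (factors-resp ≐-refl (·-identityʳ L) (diagonal L L≠0))
      (λ P J P-max F → factors-resp (≐-sym (·-identityˡ L))
        (≐-trans (·-swapˡ L P J) (P·≈P^1· P (L · J)))
        (multiply-factors 0 ℕ.z≤n P P-max F))

  -- The Chinese remainder theorem for pairs.

  maximal-distinct-comaximal : (P Q : Ideal) → IsMaximal P → IsMaximal Q → ¬ (P ≈ˢ Q) →
                               Comaximal P Q
  maximal-distinct-comaximal P Q P-max Q-max P≉Q with em (Q ⊆ˢ P)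
  ... | no Q⊈P = let x , x∈Q , x∉P = ⊈⇒∃ Q P Q⊈P in
    comaximal-mono P P ⟨ x ⟩ Q (λ y → y) (⟨⟩-least Q x∈Q) (maximal-comaximal P P-max x∉P)
  ... | yes Q⊆P with IsMaximal.maximal Q-max P Q⊆P
  ...   | inj₁ P≈Q = ⊥-elim (P≉Q P≈Q)
  ...   | inj₂ P≈⊤ = ⊥-elim (IsMaximal.proper P-max P≈⊤)

  ≈⇒-∈ : (I : Ideal) → ∀ {x y} → x ≈ y → Mem I (x - y)
  ≈⇒-∈ I {y = y} x≈y = ∈-resp I (sym (trans (+-congʳ x≈y) (-‿inverseʳ y))) (0∈ I)

  PairwiseComaximal : ∀ {r} → Vector Ideal r → Set (c ⊔ ℓ)
  PairwiseComaximal A = ∀ {i j} → i ≢ j → Comaximal (A i) (A j)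

  tail-comaximal : ∀ {r} {A : Vector Ideal (suc r)} → PairwiseComaximal A →
                   PairwiseComaximal (A ∘ suc)
  tail-comaximal co i≢j = co (i≢j ∘ suc-injective)

  head-comaximal : ∀ {r} {A : Vector Ideal (suc r)} → PairwiseComaximal A →
                   Comaximal (A zero) (∏ (A ∘ suc))
  head-comaximal {A = A} co = comaximal-∏ (A zero) (A ∘ suc) (λ i → co λ ())

  crt : (I J : Ideal) → Comaximal I J → ∀ x y → ∃[ z ] Mem I (z - x) × Mem J (z - y)
  crt I J (u , v , u∈ , v∈ , e) x y = v * x + u * y ,
    ∈-resp I (trans (solve 4 (λ u v x y → u :* (y :- x) := (v :* x :+ u :* y) :- x :* (u :+ v)) refl u v x y)
      (+-congˡ (-‿cong (trans (*-congˡ (sym e)) (*-identityʳ x))))) (∈-*ʳ I (y - x) u∈) ,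
    ∈-resp J (trans (solve 4 (λ u v x y → v :* (x :- y) := (v :* x :+ u :* y) :- y :* (u :+ v)) refl u v x y)
      (+-congˡ (-‿cong (trans (*-congˡ (sym e)) (*-identityʳ y))))) (∈-*ʳ J (x - y) v∈)

  Quotients : ∀ {r} → Vector Ideal r → Vector Ideal r → LeftModule ring c (c ⊔ ℓ)
  Quotients A B = ⨁ (λ i → DirectProduct.leftModule (𝒪 / A i) (𝒪 / B i))

  private
    module Q {r} (A B : Vector Ideal r) = LeftModule (Quotients A B)

  -- Together with `diag-cong`, `diag-injective` and `diag-surjective`, this identifies 𝒪/∏A ⊕ 𝒪/∏B
  -- with the direct sum, while the former module itself is never formed.
  diag : ∀ {r} (A B : Vector Ideal r) → Carrier × Carrier → Q.Carrierᴹ A B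
  diag {zero} A B z = Unit.tt
  diag {suc r} A B z = z , diag (A ∘ suc) (B ∘ suc) z

  diag-+ : ∀ {r} (A B : Vector Ideal r) x y x′ y′ →
           Q._≈ᴹ_ A B (diag A B (x + x′ , y + y′)) (Q._+ᴹ_ A B (diag A B (x , y)) (diag A B (x′ , y′)))
  diag-+ {zero} A B x y x′ y′ = Unit.tt
  diag-+ {suc r} A B x y x′ y′ = (≈⇒-∈ (A zero) refl , ≈⇒-∈ (B zero) refl) ,
    diag-+ (A ∘ suc) (B ∘ suc) x y x′ y′

  diag-* : ∀ {r} (A B : Vector Ideal r) s x y →
           Q._≈ᴹ_ A B (diag A B (s * x , s * y)) (Q._*ₗ_ A B s (diag A B (x , y)))
  diag-* {zero} A B s x y = Unit.tt
  diag-* {suc r} A B s x y = (≈⇒-∈ (A zero) refl , ≈⇒-∈ (B zero) refl) ,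
    diag-* (A ∘ suc) (B ∘ suc) s x y

  diag-0 : ∀ {r} (A B : Vector Ideal r) → Q._≈ᴹ_ A B (diag A B (0# , 0#)) (Q.0ᴹ A B)
  diag-0 {zero} A B = Unit.tt
  diag-0 {suc r} A B = (≈⇒-∈ (A zero) refl , ≈⇒-∈ (B zero) refl) , diag-0 (A ∘ suc) (B ∘ suc)

  diag-neg : ∀ {r} (A B : Vector Ideal r) x y →
             Q._≈ᴹ_ A B (diag A B (- x , - y)) (Q.-ᴹ_ A B (diag A B (x , y)))
  diag-neg {zero} A B x y = Unit.tt
  diag-neg {suc r} A B x y = (≈⇒-∈ (A zero) refl , ≈⇒-∈ (B zero) refl) ,
    diag-neg (A ∘ suc) (B ∘ suc) x y

  diag-cong : ∀ {r} (A B : Vector Ideal r) {x y x′ y′} →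
              Mem (∏ A) (x - x′) → Mem (∏ B) (y - y′) →
              Q._≈ᴹ_ A B (diag A B (x , y)) (diag A B (x′ , y′))
  diag-cong {zero} A B x∈ y∈ = Unit.tt
  diag-cong {suc r} A B x∈ y∈ =
    (·-⊆ˡ (A zero) (∏ (A ∘ suc)) x∈ , ·-⊆ˡ (B zero) (∏ (B ∘ suc)) y∈) ,
    diag-cong (A ∘ suc) (B ∘ suc) (·-⊆ʳ (A zero) (∏ (A ∘ suc)) x∈) (·-⊆ʳ (B zero) (∏ (B ∘ suc)) y∈)

  diag-injective : ∀ {r} (A B : Vector Ideal r) → PairwiseComaximal A → PairwiseComaximal B →
                   ∀ {x y x′ y′} → Q._≈ᴹ_ A B (diag A B (x , y)) (diag A B (x′ , y′)) →
                   Mem (∏ A) (x - x′) × Mem (∏ B) (y - y′)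
  diag-injective {zero} A B coA coB _ = Unit.tt , Unit.tt
  diag-injective {suc r} A B coA coB ((x∈ , y∈) , rest)
    with diag-injective (A ∘ suc) (B ∘ suc) (tail-comaximal {A = A} coA) (tail-comaximal {A = B} coB) rest
  ... | xs∈ , ys∈ =
    comaximal-∩ (A zero) (∏ (A ∘ suc)) (head-comaximal {A = A} coA) x∈ xs∈ ,
    comaximal-∩ (B zero) (∏ (B ∘ suc)) (head-comaximal {A = B} coB) y∈ ys∈

  diag-surjective : ∀ {r} (A B : Vector Ideal r) → PairwiseComaximal A → PairwiseComaximal B →
                    ∀ w → ∃[ x ] ∃[ y ] Q._≈ᴹ_ A B (diag A B (x , y)) w
  diag-surjective {zero} A B coA coB w = 0# , 0# , Unit.tt
  diag-surjective {suc r} A B coA coB ((x , y) , w)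
    with diag-surjective (A ∘ suc) (B ∘ suc) (tail-comaximal {A = A} coA) (tail-comaximal {A = B} coB) w
  ... | x′ , y′ , z′≈w =
    let ξ , ξ-x∈ , ξ-x′∈ = crt (A zero) (∏ (A ∘ suc)) (head-comaximal {A = A} coA) x x′
        η , η-y∈ , η-y′∈ = crt (B zero) (∏ (B ∘ suc)) (head-comaximal {A = B} coB) y y′
    in ξ , η , (ξ-x∈ , η-y∈) ,
       Q.≈ᴹ-trans (A ∘ suc) (B ∘ suc) (diag-cong (A ∘ suc) (B ∘ suc) ξ-x′∈ η-y′∈) z′≈w

  comaximal-powers : ∀ {r} (𝔪 : Vector Ideal r) → (∀ i → IsMaximal (𝔪 i)) →
                     (∀ {i j} → i ≢ j → ¬ (𝔪 i ≈ˢ 𝔪 j)) → (e : Vector ℕ r) →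
                     PairwiseComaximal (λ i → 𝔪 i ^ᴵ e i)
  comaximal-powers 𝔪 max distinct e {i} {j} i≢j = comaximal-^ (𝔪 i ^ᴵ e i) (𝔪 j)
    (comaximal-sym (𝔪 j) (𝔪 i ^ᴵ e i) (comaximal-^ (𝔪 j) (𝔪 i)
      (maximal-distinct-comaximal (𝔪 j) (𝔪 i) (max j) (max i) (distinct (i≢j ∘ ≡.sym))) (e i)))
    (e j)

  -- Lattices attached to points.

  module Lattices (L K : Ideal) (K⊆L : K ⊆ˢ L) where

    lattice : Carrier → Carrier → Submodule 𝒪² (c ⊔ ℓ)
    lattice a b = record
      { Mem = λ (x , y) → Mem L x × Mem L y × Mem K (a * y - b * x)
      ; resp = λ (x≈ , y≈) (x∈ , y∈ , z∈) → ∈-resp L x≈ x∈ , ∈-resp L y≈ y∈ ,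
          ∈-resp K (+-cong (*-congˡ y≈) (-‿cong (*-congˡ x≈))) z∈
      ; 0-mem = 0∈ L , 0∈ L ,
          ∈-resp K (solve 2 (λ a b → con ℤ.0ℤ := a :* con ℤ.0ℤ :- b :* con ℤ.0ℤ) refl a b) (0∈ K)
      ; +-mem = λ {(x , y)} {(x′ , y′)} (x∈ , y∈ , z∈) (x′∈ , y′∈ , z′∈) →
          ∈-+ L x∈ x′∈ , ∈-+ L y∈ y′∈ ,
          ∈-resp K (solve 6 (λ a b x y x′ y′ →
            (a :* y :- b :* x) :+ (a :* y′ :- b :* x′) := a :* (y :+ y′) :- b :* (x :+ x′))
            refl a b x y x′ y′) (∈-+ K z∈ z′∈)
      ; *-mem = λ { r {(x , y)} (x∈ , y∈ , z∈) → ∈-* L r x∈ , ∈-* L r y∈ ,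
          ∈-resp K (solve 5 (λ a b x y r →
            r :* (a :* y :- b :* x) := a :* (r :* y) :- b :* (r :* x)) refl a b x y r)
            (∈-* K r z∈) } }

    module Coordinates {a b u v : Carrier} (1≈ : 1# ≈ u * a + v * b) where

      ξ η : Carrier → Carrier → Carrier
      ξ x y = u * x + v * y
      η x y = a * y - b * x

      private
        by-1 : ∀ x → x * (u * a + v * b) ≈ x
        by-1 x = trans (*-congˡ (sym 1≈)) (*-identityʳ x)

      -- The coordinate matrix with rows (u , v) and (- b , a) has determinant u a + v b = 1; its
      -- inverse has rows (a , - v) and (b , u).
      x-recovered : ∀ x y → a * ξ x y - v * η x y ≈ x
      x-recovered x y = trans (solve 6 (λ a b u v x y →
        a :* (u :* x :+ v :* y) :- v :* (a :* y :- b :* x) := x :* (u :* a :+ v :* b))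
        refl a b u v x y) (by-1 x)

      y-recovered : ∀ x y → b * ξ x y + u * η x y ≈ y
      y-recovered x y = trans (solve 6 (λ a b u v x y →
        b :* (u :* x :+ v :* y) :+ u :* (a :* y :- b :* x) := y :* (u :* a :+ v :* b))
        refl a b u v x y) (by-1 y)

      ξ-recovered : ∀ p q → ξ (a * p - v * q) (b * p + u * q) ≈ p
      ξ-recovered p q = trans (solve 6 (λ a b u v p q →
        u :* (a :* p :- v :* q) :+ v :* (b :* p :+ u :* q) := p :* (u :* a :+ v :* b))
        refl a b u v p q) (by-1 p)

      η-recovered : ∀ p q → η (a * p - v * q) (b * p + u * q) ≈ q
      η-recovered p q = trans (solve 6 (λ a b u v p q →
        a :* (b :* p :+ u :* q) :- b :* (a :* p :- v :* q) := q :* (u :* a :+ v :* b))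
        refl a b u v p q) (by-1 q)

      coordinates-mem : ∀ {x y} → Mem (lattice a b) (x , y) → Mem L (ξ x y) × Mem K (η x y)
      coordinates-mem (x∈ , y∈ , η∈) = ∈-+ L (∈-* L u x∈) (∈-* L v y∈) , η∈

      coordinates-mem⁻¹ : ∀ {x y} → Mem L (ξ x y) → Mem K (η x y) → Mem (lattice a b) (x , y)
      coordinates-mem⁻¹ {x} {y} ξ∈ η∈ =
        ∈-resp L (x-recovered x y) (∈-+ L (∈-* L a ξ∈) (-‿mem L (∈-* L v (K⊆L η∈)))) ,
        ∈-resp L (y-recovered x y) (∈-+ L (∈-* L b ξ∈) (∈-* L u (K⊆L η∈))) ,
        η∈

      ξ-- : ∀ x y x′ y′ → ξ x y - ξ x′ y′ ≈ ξ (x - x′) (y - y′)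
      ξ-- x y x′ y′ = solve 6 (λ u v x y x′ y′ →
        (u :* x :+ v :* y) :- (u :* x′ :+ v :* y′) := u :* (x :- x′) :+ v :* (y :- y′))
        refl u v x y x′ y′

      η-- : ∀ x y x′ y′ → η x y - η x′ y′ ≈ η (x - x′) (y - y′)
      η-- x y x′ y′ = solve 6 (λ a b x y x′ y′ →
        (a :* y :- b :* x) :- (a :* y′ :- b :* x′) := a :* (y :- y′) :- b :* (x :- x′))
        refl a b x y x′ y′

      invariant-factors : Factors L K → HasInvariantFactors (lattice a b) L K
      invariant-factors F = record
        { Factors F
        ; quotient-≅ = f , record
          { isLeftModuleMonomorphism = record
            { isLeftModuleHomomorphism = record
              { +ᴹ-isGroupHomomorphism = record
                { isMonoidHomomorphism = record
                  { isMagmaHomomorphism = record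
                    { isRelHomomorphism = record { cong = λ {z} {z′} → f-cong z z′ }
                    ; homo = f-+ }
                  ; ε-homo = M.≈ᴹ-trans
                      (diag-≈ (solve 2 (λ u v → u :* con ℤ.0ℤ :+ v :* con ℤ.0ℤ := con ℤ.0ℤ) refl u v)
                              (solve 2 (λ a b → a :* con ℤ.0ℤ :- b :* con ℤ.0ℤ := con ℤ.0ℤ) refl a b))
                      (diag-0 A B) }
                ; ⁻¹-homo = λ (x , y) → M.≈ᴹ-trans
                    (diag-≈ (solve 4 (λ u v x y → u :* (:- x) :+ v :* (:- y) := :- (u :* x :+ v :* y)) refl u v x y)
                            (solve 4 (λ a b x y → a :* (:- y) :- b :* (:- x) := :- (a :* y :- b :* x)) refl a b x y))
                    (diag-neg A B (ξ x y) (η x y)) }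
              ; *ₗ-homo = λ s (x , y) → M.≈ᴹ-trans
                  (diag-≈ (solve 5 (λ u v x y s → u :* (s :* x) :+ v :* (s :* y) := s :* (u :* x :+ v :* y)) refl u v x y s)
                          (solve 5 (λ a b x y s → a :* (s :* y) :- b :* (s :* x) := s :* (a :* y :- b :* x)) refl a b x y s))
                  (diag-* A B s (ξ x y) (η x y)) }
            ; injective = λ {z} {z′} → f-injective z z′ }
          ; surjective = f-surjective } }
        where
        open Factors F

        A B : Vector Ideal r
        A i = 𝔪 i ^ᴵ l i
        B i = 𝔪 i ^ᴵ k i

        module M = Q A B

        f : Carrier × Carrier → M.Carrierᴹ
        f (x , y) = diag A B (ξ x y , η x y)

        diag-≈ : ∀ {x y x′ y′} → x ≈ x′ → y ≈ y′ → diag A B (x , y) M.≈ᴹ diag A B (x′ , y′)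
        diag-≈ x≈ y≈ = diag-cong A B (≈⇒-∈ (∏ A) x≈) (≈⇒-∈ (∏ B) y≈)

        f-cong : ∀ z z′ → LeftModule._≈ᴹ_ (𝒪² / lattice a b) z z′ → f z M.≈ᴹ f z′
        f-cong (x , y) (x′ , y′) z-z′∈ = let ξ∈ , η∈ = coordinates-mem z-z′∈ in
          diag-cong A B
            (proj₁ L-factors (∈-resp L (sym (ξ-- x y x′ y′)) ξ∈))
            (proj₁ K-factors (∈-resp K (sym (η-- x y x′ y′)) η∈))

        f-injective : ∀ z z′ → f z M.≈ᴹ f z′ → LeftModule._≈ᴹ_ (𝒪² / lattice a b) z z′
        f-injective (x , y) (x′ , y′) fz≈fz′ =
          let ξ∈ , η∈ = diag-injective A B (comaximal-powers 𝔪 𝔪-maximal 𝔪-distinct l)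
                          (comaximal-powers 𝔪 𝔪-maximal 𝔪-distinct k) fz≈fz′
          in coordinates-mem⁻¹ (∈-resp L (ξ-- x y x′ y′) (proj₂ L-factors ξ∈))
                               (∈-resp K (η-- x y x′ y′) (proj₂ K-factors η∈))

        f-+ : ∀ z z′ → f (LeftModule._+ᴹ_ 𝒪² z z′) M.≈ᴹ (f z M.+ᴹ f z′)
        f-+ (x , y) (x′ , y′) = M.≈ᴹ-trans
          (diag-≈
            (solve 6 (λ u v x y x′ y′ →
              u :* (x :+ x′) :+ v :* (y :+ y′) := (u :* x :+ v :* y) :+ (u :* x′ :+ v :* y′))
              refl u v x y x′ y′)
            (solve 6 (λ a b x y x′ y′ →
              a :* (y :+ y′) :- b :* (x :+ x′) := (a :* y :- b :* x) :+ (a :* y′ :- b :* x′))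
              refl a b x y x′ y′))
          (diag-+ A B (ξ x y) (η x y) (ξ x′ y′) (η x′ y′))

        f-surjective : ∀ w → ∃[ z ] (∀ {z′} → LeftModule._≈ᴹ_ (𝒪² / lattice a b) z′ z → f z′ M.≈ᴹ w)
        f-surjective w =
          let p , q , pq≈w = diag-surjective A B (comaximal-powers 𝔪 𝔪-maximal 𝔪-distinct l)
                               (comaximal-powers 𝔪 𝔪-maximal 𝔪-distinct k) w
              z = a * p - v * q , b * p + u * q
          in z , λ {z′} z′≈z → M.≈ᴹ-trans (f-cong z′ z z′≈z)
               (M.≈ᴹ-trans (diag-≈ (ξ-recovered p q) (η-recovered p q)) pq≈w)

      -- In coordinates, a′ y - b′ x equals (u a′ + v b′) η - δ ξ with δ = a b′ - b a′. The first
      -- term lies in K because η does, the second because ξ is in L and δ in I.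
      lattice-⊆ : ∀ {a′ b′} I → K ≈ˢ L · I → Mem I (a * b′ - b * a′) →
                  lattice a b ⊆ˢ lattice a′ b′
      lattice-⊆ {a′} {b′} I (_ , LI⊆K) δ∈ {x , y} z∈@(x∈ , y∈ , η∈) = x∈ , y∈ , ∈-resp K
        (trans (solve 8 (λ a b a′ b′ u v ξ η →
            (u :* a′ :+ v :* b′) :* η :- ξ :* (a :* b′ :- b :* a′)
            := a′ :* (b :* ξ :+ u :* η) :- b′ :* (a :* ξ :- v :* η))
            refl a b a′ b′ u v (ξ x y) (η x y))
          (+-cong (*-congˡ (y-recovered x y)) (-‿cong (*-congˡ (x-recovered x y)))))
        (∈-+ K (∈-* K _ η∈) (-‿mem K (LI⊆K (·-mem L I (proj₁ (coordinates-mem z∈)) δ∈))))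

    -- The test vectors are t (a , b) with t in L: the form of (a , b) vanishes on them, and that of
    -- (a′ , b′) takes the value - t (a b′ - b a′).
    lattice-⊆⁻¹ : ∀ {a b a′ b′} I → IsNonzero L → K ≈ˢ L · I →
                  lattice a b ⊆ˢ lattice a′ b′ → Mem I (a * b′ - b * a′)
    lattice-⊆⁻¹ {a} {b} {a′} {b′} I L≠0 (K⊆LI , _) N⊆N′ = ·-cancelˡ L I L≠0 λ {t} t∈ →
      let _ , _ , η∈ = N⊆N′ {t * a , t * b} (∈-*ʳ L a t∈ , ∈-*ʳ L b t∈ ,
            ∈-resp K (solve 3 (λ a b t → con ℤ.0ℤ := a :* (t :* b) :- b :* (t :* a)) refl a b t) (0∈ K))
      in K⊆LI (∈-resp K
        (solve 5 (λ a b a′ b′ t →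
          :- (a′ :* (t :* b) :- b′ :* (t :* a)) := t :* (a :* b′ :- b :* a′)) refl a b a′ b′ t)
        (-‿mem K η∈))

    K·𝒪²⊆lattice : ∀ {a b x y} → Mem K x → Mem K y → Mem (lattice a b) (x , y)
    K·𝒪²⊆lattice {a} {b} x∈ y∈ = K⊆L x∈ , K⊆L y∈ , ∈-+ K (∈-* K a y∈) (-‿mem K (∈-* K b x∈))

    lattice-cotorsion : IsNonzero K → ∀ a b → IsTorsion (𝒪² / lattice a b)
    lattice-cotorsion K≠0 a b (x , y) = let κ , κ∈ , κ≉0 = nonzero-element K K≠0 in
      κ , κ≉0 , K·𝒪²⊆lattice
        (∈-resp K (solve 2 (λ k x → k :* x := k :* x :- con ℤ.0ℤ) refl κ x) (∈-*ʳ K x κ∈))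
        (∈-resp K (solve 2 (λ k x → k :* x := k :* x :- con ℤ.0ℤ) refl κ y) (∈-*ʳ K y κ∈))

    lattice-rankTwo : IsNonzero K → ∀ a b → HasRank (lattice a b) 2
    lattice-rankTwo K≠0 a b = basis ,
      (λ { zero → K·𝒪²⊆lattice κ∈ (0∈ K) ; (suc zero) → K·𝒪²⊆lattice (0∈ K) κ∈ }) ,
      (λ s (e , e′) → λ where
        zero → cancel (trans (solve 3 (λ k s t →
          k :* s := s :* k :+ (t :* con ℤ.0ℤ :+ con ℤ.0ℤ)) refl κ (s zero) (s (suc zero))) e)
        (suc zero) → cancel (trans (solve 3 (λ k s t →
          k :* t := s :* con ℤ.0ℤ :+ (t :* k :+ con ℤ.0ℤ)) refl κ (s zero) (s (suc zero))) e′)) ,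
      -- The relation κ (x , y) - x (κ , 0) - y (0 , κ) = 0 has the nonzero leading coefficient κ.
      λ (x , y) _ independent → κ≉0 (independent (κ Vector.∷ (- x) Vector.∷ (- y) Vector.∷ Vector.[])
        ( solve 3 (λ k x y → k :* x :+ ((:- x) :* k :+ ((:- y) :* con ℤ.0ℤ :+ con ℤ.0ℤ)) := con ℤ.0ℤ) refl κ x y
        , solve 3 (λ k x y → k :* y :+ ((:- x) :* con ℤ.0ℤ :+ ((:- y) :* k :+ con ℤ.0ℤ)) := con ℤ.0ℤ) refl κ x y)
        zero)
      where
      κ : Carrier
      κ = proj₁ (nonzero-element K K≠0)

      κ∈ : Mem K κ
      κ∈ = proj₁ (proj₂ (nonzero-element K K≠0))

      κ≉0 : κ ≉ 0#
      κ≉0 = proj₂ (proj₂ (nonzero-element K K≠0))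

      basis : Vector (Carrier × Carrier) 2
      basis = (κ , 0#) Vector.∷ (0# , κ) Vector.∷ Vector.[]

      cancel : ∀ {x} → κ * x ≈ 0# → x ≈ 0#
      cancel κx≈0 = *-cancelˡ κ≉0 (trans κx≈0 (sym (zeroʳ κ)))

    -- From a submodule with given invariant factors to a point.

    -- M is the kernel of a surjection (σ, τ) : 𝒪² → 𝒪/L ⊕ 𝒪/K, where
    -- σ (x, y) = x s₁ + y s₂ and τ (x, y) = x t₁ + y t₂; the vectors p and q
    -- are mapped to (1, 0) and (0, 1).
    record Presentation (M : Submodule 𝒪² (c ⊔ ℓ)) : Set (c ⊔ ℓ) where
      field
        s₁ s₂ t₁ t₂ p₁ p₂ q₁ q₂ : Carrier
        kernel : ∀ {x y} → Mem M (x , y) → Mem L (x * s₁ + y * s₂) × Mem K (x * t₁ + y * t₂)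
        kernel⁻¹ : ∀ {x y} → Mem L (x * s₁ + y * s₂) → Mem K (x * t₁ + y * t₂) → Mem M (x , y)
        σp : Mem L (1# - (p₁ * s₁ + p₂ * s₂))
        σq : Mem L (0# - (q₁ * s₁ + q₂ * s₂))
        τq : Mem K (1# - (q₁ * t₁ + q₂ * t₂))

    -- Lifting the images of the two unit vectors through `diag` gives the columns s and t. Pulling
    -- `diag` of (1 , 0) and (0 , 1) back through the isomorphism gives p and q.
    presentation : (M : Submodule 𝒪² (c ⊔ ℓ)) → HasInvariantFactors M L K → Presentation M
    presentation M H = record
      { s₁ = s₁ ; s₂ = s₂ ; t₁ = t₁ ; t₂ = t₂
      ; p₁ = p₁ ; p₂ = p₂ ; q₁ = q₁ ; q₂ = q₂
      ; kernel = λ {x} {y} z∈ →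
          let σ∈ , τ∈ = diag⁻¹ (N.≈ᴹ-trans (N.≈ᴹ-sym (f-diag x y))
                (N.≈ᴹ-trans (f.⟦⟧-cong (M.resp (x≈x-0 x , x≈x-0 y) z∈)) (N.≈ᴹ-trans f.0ᴹ-homo (N.≈ᴹ-sym (diag-0 A B)))))
          in ∈-resp L (x-0 _) σ∈ , ∈-resp K (x-0 _) τ∈
      ; kernel⁻¹ = λ {x} {y} σ∈ τ∈ → M.resp (x-0 x , x-0 y) (f.injective
          (N.≈ᴹ-trans (f-diag x y) (N.≈ᴹ-trans
            (diag-cong A B (proj₁ L-factors (∈-resp L (x≈x-0 _) σ∈)) (proj₁ K-factors (∈-resp K (x≈x-0 _) τ∈)))
            (N.≈ᴹ-trans (diag-0 A B) (N.≈ᴹ-sym f.0ᴹ-homo)))))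
      ; σp = proj₁ at-p ; σq = proj₁ at-q ; τq = proj₂ at-q }
      where
      open HasInvariantFactors H
      module M = Submodule M

      A B : Vector Ideal r
      A i = 𝔪 i ^ᴵ l i
      B i = 𝔪 i ^ᴵ k i

      module N = LeftModule (Quotients A B)

      f : Carrier × Carrier → N.Carrierᴹ
      f = proj₁ quotient-≅

      module f = IsLeftModuleIsomorphism (proj₂ quotient-≅)

      coA : PairwiseComaximal A
      coA = comaximal-powers 𝔪 𝔪-maximal 𝔪-distinct l

      coB : PairwiseComaximal B
      coB = comaximal-powers 𝔪 𝔪-maximal 𝔪-distinct k

      x-0 : ∀ x → x - 0# ≈ x
      x-0 = solve 1 (λ x → x :- con ℤ.0ℤ := x) refl

      x≈x-0 : ∀ x → x ≈ x - 0#
      x≈x-0 x = sym (x-0 x)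

      diag⁻¹ : ∀ {x y x′ y′} → diag A B (x , y) N.≈ᴹ diag A B (x′ , y′) →
               Mem L (x - x′) × Mem K (y - y′)
      diag⁻¹ e = let x∈ , y∈ = diag-injective A B coA coB e in
        proj₂ L-factors x∈ , proj₂ K-factors y∈

      image₁ : ∃[ s ] ∃[ t ] diag A B (s , t) N.≈ᴹ f (1# , 0#)
      image₁ = diag-surjective A B coA coB (f (1# , 0#))

      image₂ : ∃[ s ] ∃[ t ] diag A B (s , t) N.≈ᴹ f (0# , 1#)
      image₂ = diag-surjective A B coA coB (f (0# , 1#))

      s₁ s₂ t₁ t₂ : Carrier
      s₁ = proj₁ image₁
      t₁ = proj₁ (proj₂ image₁)
      s₂ = proj₁ image₂
      t₂ = proj₁ (proj₂ image₂)

      f-diag : ∀ x y → f (x , y) N.≈ᴹ diag A B (x * s₁ + y * s₂ , x * t₁ + y * t₂)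
      f-diag x y = begin
        f (x , y)
          ≈⟨ f.⟦⟧-cong (M.resp
               ( solve 2 (λ x y → con ℤ.0ℤ := x :- (x :* con ℤ.1ℤ :+ y :* con ℤ.0ℤ)) refl x y
               , solve 2 (λ x y → con ℤ.0ℤ := y :- (x :* con ℤ.0ℤ :+ y :* con ℤ.1ℤ)) refl x y) M.0-mem) ⟩
        f (x * 1# + y * 0# , x * 0# + y * 1#)
          ≈⟨ f.+ᴹ-homo (x * 1# , x * 0#) (y * 0# , y * 1#) ⟩
        f (x * 1# , x * 0#) N.+ᴹ f (y * 0# , y * 1#)
          ≈⟨ N.+ᴹ-cong (image x (1# , 0#) image₁) (image y (0# , 1#) image₂) ⟩
        diag A B (x * s₁ , x * t₁) N.+ᴹ diag A B (y * s₂ , y * t₂)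
          ≈⟨ diag-+ A B _ _ _ _ ⟨
        diag A B (x * s₁ + y * s₂ , x * t₁ + y * t₂) ∎
        where
        open SetoidReasoning N.≈ᴹ-setoid

        image : ∀ x e ((s , t , _) : ∃[ s ] ∃[ t ] diag A B (s , t) N.≈ᴹ f e) →
                f (LeftModule._*ₗ_ 𝒪² x e) N.≈ᴹ diag A B (x * s , x * t)
        image x e (s , t , st≈) = N.≈ᴹ-trans (f.*ₗ-homo x e)
          (N.≈ᴹ-trans (N.*ₗ-congˡ (N.≈ᴹ-sym st≈)) (N.≈ᴹ-sym (diag-* A B x s t)))

      preimage : ∀ x y → ∃[ z ] diag A B (x , y) N.≈ᴹ f z
      preimage x y = let z , fz≈ = f.surjective (diag A B (x , y)) in
        z , N.≈ᴹ-sym (fz≈ {z} (LeftModule.≈ᴹ-refl (𝒪² / M) {z}))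

      p q : ∃[ z ] _
      p = preimage 1# 0#
      q = preimage 0# 1#

      p₁ p₂ q₁ q₂ : Carrier
      p₁ = proj₁ (proj₁ p)
      p₂ = proj₂ (proj₁ p)
      q₁ = proj₁ (proj₁ q)
      q₂ = proj₂ (proj₁ q)

      at-p : Mem L (1# - (p₁ * s₁ + p₂ * s₂)) × Mem K (0# - (p₁ * t₁ + p₂ * t₂))
      at-p = diag⁻¹ (N.≈ᴹ-trans (proj₂ p) (f-diag p₁ p₂))

      at-q : Mem L (0# - (q₁ * s₁ + q₂ * s₂)) × Mem K (1# - (q₁ * t₁ + q₂ * t₂))
      at-q = diag⁻¹ (N.≈ᴹ-trans (proj₂ q) (f-diag q₁ q₂))

    module _ (M : Submodule 𝒪² (c ⊔ ℓ)) (H : Presentation M) where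

      open Presentation H

      private
        det-pq det-st : Carrier
        det-pq = p₁ * q₂ - p₂ * q₁
        det-st = s₁ * t₂ - s₂ * t₁

        -- Modulo L, the matrix with columns s and t has an inverse, the one
        -- with rows p and q.
        1-det∈L : Mem L (1# - det-pq * det-st)
        1-det∈L = ∈-resp L
          (solve 8 (λ p₁ p₂ q₁ q₂ s₁ s₂ t₁ t₂ →
            (con ℤ.1ℤ :- (p₁ :* s₁ :+ p₂ :* s₂))
            :+ ((p₁ :* s₁ :+ p₂ :* s₂) :* (con ℤ.1ℤ :- (q₁ :* t₁ :+ q₂ :* t₂))
            :+ (con ℤ.0ℤ :- (p₁ :* t₁ :+ p₂ :* t₂)) :* (con ℤ.0ℤ :- (q₁ :* s₁ :+ q₂ :* s₂)))
            := con ℤ.1ℤ :- (p₁ :* q₂ :- p₂ :* q₁) :* (s₁ :* t₂ :- s₂ :* t₁))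
            refl p₁ p₂ q₁ q₂ s₁ s₂ t₁ t₂)
          (∈-+ L σp (∈-+ L (∈-* L _ (K⊆L τq)) (∈-* L _ σq)))

        -- `det-pq` inverts `det-st` modulo L.
        ∈-det : ∀ {x} → Mem L (x * det-st) → Mem L x
        ∈-det {x} x-det∈ = ∈-resp L
          (solve 3 (λ x d e → x :* (con ℤ.1ℤ :- d :* e) :+ d :* (x :* e) := x) refl x det-pq det-st)
          (∈-+ L (∈-* L x 1-det∈L) (∈-* L det-pq x-det∈))

      -- Cramer's rule: σ z and τ z both lie in L, hence so do x and y times the determinant, which
      -- is a unit modulo L.
      presentation-⊆L : ∀ {x y} → Mem M (x , y) → Mem L x × Mem L y × Mem K (x * t₁ + y * t₂)
      presentation-⊆L {x} {y} z∈ = let σ∈ , τ∈ = kernel z∈ in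
        ∈-det (∈-resp L
          (solve 6 (λ x y s₁ s₂ t₁ t₂ →
            t₂ :* (x :* s₁ :+ y :* s₂) :- s₂ :* (x :* t₁ :+ y :* t₂)
            := x :* (s₁ :* t₂ :- s₂ :* t₁)) refl x y s₁ s₂ t₁ t₂)
          (∈-+ L (∈-* L t₂ σ∈) (-‿mem L (∈-* L s₂ (K⊆L τ∈))))) ,
        ∈-det (∈-resp L
          (solve 6 (λ x y s₁ s₂ t₁ t₂ →
            s₁ :* (x :* t₁ :+ y :* t₂) :- t₁ :* (x :* s₁ :+ y :* s₂)
            := y :* (s₁ :* t₂ :- s₂ :* t₁)) refl x y s₁ s₂ t₁ t₂)
          (∈-+ L (∈-* L s₁ (K⊆L τ∈)) (-‿mem L (∈-* L t₁ σ∈)))) ,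
        τ∈

      -- On L² the condition on σ is automatic, and τ z = t₂ y - (- t₁) x is the form of the point
      -- (t₂ , - t₁). Changing its coefficients modulo K changes its values by elements of K.
      presentation-≈-lattice : ∀ {a b} → Mem K (a - t₂) → Mem K (b - - t₁) → M ≈ˢ lattice a b
      presentation-≈-lattice {a} {b} a-∈ b-∈ =
        (λ {(x , y)} z∈ → let x∈ , y∈ , τ∈ = presentation-⊆L z∈ in
          x∈ , y∈ , ∈-resp K
            (solve 6 (λ x y a b t₁ t₂ →
              (y :* (a :- t₂) :- x :* (b :- (:- t₁))) :+ (x :* t₁ :+ y :* t₂)
              := a :* y :- b :* x) refl x y a b t₁ t₂)
            (∈-+ K (difference x y) τ∈)) ,
        λ {(x , y)} (x∈ , y∈ , η∈) → kernel⁻¹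
          (∈-+ L (∈-*ʳ L s₁ x∈) (∈-*ʳ L s₂ y∈))
          (∈-resp K
            (solve 6 (λ x y a b t₁ t₂ →
              (a :* y :- b :* x) :- (y :* (a :- t₂) :- x :* (b :- (:- t₁)))
              := x :* t₁ :+ y :* t₂) refl x y a b t₁ t₂)
            (∈-+ K η∈ (-‿mem K (difference x y))))
        where
        difference : ∀ x y → Mem K (y * (a - t₂) - x * (b - - t₁))
        difference x y = ∈-+ K (∈-* K y a-∈) (-‿mem K (∈-* K x b-∈))

      presentation-unimodular : Mem K (1# - (q₂ * t₂ + - q₁ * - t₁))
      presentation-unimodular = ∈-resp K
        (solve 4 (λ q₁ q₂ t₁ t₂ → con ℤ.1ℤ :- (q₁ :* t₁ :+ q₂ :* t₂)
          := con ℤ.1ℤ :- (q₂ :* t₂ :+ (:- q₁) :* (:- t₁))) refl q₁ q₂ t₁ t₂) τq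

      presentation-lattice : IsNonzero K →
        ∃[ a ] ∃[ b ] Comaximal ⟨ a ⟩ ⟨ b ⟩ × M ≈ˢ lattice a b
      presentation-lattice K≠0 = conclude
        (unimodular-lift K K≠0 q₂ (- q₁) t₂ (- t₁) presentation-unimodular)
        where
        conclude : ∃[ a ] ∃[ b ] Comaximal ⟨ a ⟩ ⟨ b ⟩ × Mem K (a - t₂) × Mem K (b - - t₁) →
                   ∃[ a ] ∃[ b ] Comaximal ⟨ a ⟩ ⟨ b ⟩ × M ≈ˢ lattice a b
        conclude (a , b , co , a-∈ , b-∈) = a , b , co , presentation-≈-lattice a-∈ b-∈

-- The bijection between submodules and points.

theorem5p1 : {c ℓ : Level} (O : CommutativeRing c ℓ) (let open OverRing O) →
    IsDedekindDomain →
    (L K I : Ideal) → IsNonzero L → IsNonzero K → K ⊆ˢ L → K ≈ˢ L · I →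
    Inverse (CotorsionSubmodules L K) (PF¹ I)
theorem5p1 {c} {ℓ} O isDedekind L K I L≠0 K≠0 K⊆L K≈LI = record
  { to = to
  ; from = from
  -- `to` depends on the given isomorphism and on chosen preimages and lifts. It is well defined
  -- because M is the lattice of its point and equal lattices have equal points; the inverse laws
  -- follow from the same two facts and `from-cong`.
  ; to-cong = λ {M} {M′} M≈M′ →
      lattice-⊆⁻¹ I L≠0 K≈LI (proj₁ (≐-trans (≐-sym (to-lattice M)) (≐-trans M≈M′ (to-lattice M′))))
  ; from-cong = λ {p} {p′} → from-cong p p′
  ; inverse =
      (λ {p} {M} M≈ → lattice-⊆⁻¹ I L≠0 K≈LI (proj₁ (≐-trans (≐-sym (to-lattice M)) M≈))) ,
      λ {M} {p} p≈ → ≐-trans (from-cong p (to M) p≈) (≐-sym (to-lattice M)) }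
  where
  open CommutativeRing O using (Carrier; 1#; _≈_; _+_; _*_; trans; +-cong)
  open OverRing O
  open IdealArithmetic O
  open Dedekind O isDedekind
  open Lattices L K K⊆L
  open CotorsionSubmodule

  module PF¹ = Setoid (PF¹ I)

  I≠0 : IsNonzero I
  I≠0 = nonzero-mono K I (λ x∈ → ·-⊆ʳ L I (proj₁ K≈LI x∈)) K≠0

  factors : Factors L K
  factors = factors-resp ≐-refl K≈LI (factorise L I L≠0 I≠0)

  bezout : ∀ {a b} → Comaximal ⟨ a ⟩ ⟨ b ⟩ → ∃[ u ] ∃[ v ] 1# ≈ u * a + v * b
  bezout (_ , _ , (u , ua≈) , (v , vb≈) , e) = u , v , trans e (+-cong ua≈ vb≈)

  from : Unimodular → CotorsionSubmodule L K
  from ((a , b) , _ , ⊤⊆) = record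
    { submodule = lattice a b
    ; cotorsion = lattice-cotorsion K≠0 a b
    ; rankTwo = lattice-rankTwo K≠0 a b
    ; invariantFactors = Coordinates.invariant-factors (proj₂ (proj₂ (bezout (⊤⊆ Unit.tt)))) factors }

  from-cong : ∀ p p′ → p PF¹.≈ p′ → submodule (from p) ≈ˢ submodule (from p′)
  from-cong p@(_ , _ , ⊤⊆) p′@(_ , _ , ⊤⊆′) p≈p′ =
    Coordinates.lattice-⊆ (proj₂ (proj₂ (bezout (⊤⊆ Unit.tt)))) I K≈LI p≈p′ ,
    Coordinates.lattice-⊆ (proj₂ (proj₂ (bezout (⊤⊆′ Unit.tt)))) I K≈LI (PF¹.sym {p} {p′} p≈p′)

  point : (M : CotorsionSubmodule L K) →
          ∃[ a ] ∃[ b ] Comaximal ⟨ a ⟩ ⟨ b ⟩ × submodule M ≈ˢ lattice a b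
  point M = presentation-lattice (submodule M) (presentation (submodule M) (invariantFactors M)) K≠0

  to : CotorsionSubmodule L K → Unimodular
  to M = let a , b , co , _ = point M in (a , b) , 1∈⇒unit (⟨ a ⟩ +ᴵ ⟨ b ⟩) co

  to-lattice : ∀ M → submodule M ≈ˢ submodule (from (to M))
  to-lattice M = proj₂ (proj₂ (proj₂ (point M)))
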